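{- Let $H$ be a colored graph such that $\widehat H$ has treewidth at most $w$ and $H$ has no $c$-flower centered at any of its color classes. Then one can compute a guarded cutvertex decomposition $(T,\beta,g)$ of $H$ with guard size $O((w+c)^2w^2)$ such that every bag contains vertices of at most $O((c+w)w)$ colors.
   Context: A colored graph is a finite simple graph $H$ with a (not necessarily proper) vertex coloring with color classes $C_i$. $\widehat H$ is the simple graph with one vertex per color class, two being adjacent iff $H$ has an edge between the classes. $H^{\bullet}$ is obtained from $H$ by making every color class a clique; $H^{\bullet\setminus i}$ by making every color class except $C_i$ a clique. A $c$-flower centered at $C_i$ is a collection of $c$ pairwise vertex-disjoint paths of length at least $1$ in $H^{\bullet\setminus i}$, each with both endpoints in $C_i$. For a rooted tree decomposition $(T,\beta)$, $\sigma(t)=\beta(t)\cap\beta(\text{parent}(t))$ and $\sigma(\text{root})=\emptyset$. A guarded cutvertex decomposition of $H$ is $(T,\beta,g)$ with $(T,\beta)$ a rooted tree decomposition of $H^{\bullet}$ and $\sigma(t)\subseteq g(t)\subseteq\beta(t)$ for all $t$, such that $g(t)$ is a vertex cover of $H[\beta(t)]$ for every $t$, and $|\sigma(t')\setminus g(t)|\le1$ for every $t$ and child $t'$ of $t$. The guard size is $\max_t|g(t)|$. -}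

module Defs where

open import Data.Nat using (ℕ; zero; suc; _≤_)
open import Data.Bool using (Bool; true; false)
open import Data.Fin using (Fin; zero; suc; toℕ; inject₁; fromℕ; _≟_)
open import Data.Fin.Properties using (any?)
open import Data.Fin.Subset using (Subset; _∈_; _⊆_; _∩_; _─_; ∣_∣) renaming (⊥ to ∅)
open import Data.Fin.Subset.Properties using (_∈?_)
open import Data.Vec using (tabulate)
open import Data.Product using (Σ; ∃; ∃-syntax; _×_; _,_)
open import Data.Product.Properties using () 
open import Relation.Nullary.Decidable using (does; _×-dec_)
open import Data.Sum using (_⊎_)
open import Data.Empty using (⊥)
open import Relation.Nullary using (¬_)
open import Relation.Binary.PropositionalEquality using (_≡_; _≢_)

-- Colored graphs.  Vertices are Fin n; the coloring is col : Fin n → Fin k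
-- (colors not used by any vertex give empty classes; these are harmless:
-- they are isolated vertices of Ĥ and cannot be centers of flowers).

record ColoredGraph : Set where
  field
    n      : ℕ
    k      : ℕ
    E      : Fin n → Fin n → Bool
    E-sym  : ∀ u v → E u v ≡ E v u
    E-irr  : ∀ u → E u u ≡ false
    col    : Fin n → Fin k

  Adj : Fin n → Fin n → Set
  Adj u v = E u v ≡ true

  AdjBullet : Fin n → Fin n → Set
  AdjBullet u v = Adj u v ⊎ (col u ≡ col v × u ≢ v)

  AdjBulletExcept : Fin k → Fin n → Fin n → Set
  AdjBulletExcept i u v = Adj u v ⊎ (col u ≡ col v × col u ≢ i × u ≢ v)

  AdjHat : Fin k → Fin k → Set
  AdjHat i j = i ≢ j × ∃[ u ] ∃[ v ] (col u ≡ i × col v ≡ j × Adj u v)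

-- Rooted trees: nodes Fin (suc m), root = zero, every non-root node
-- suc i has a parent (parent i) which is numbered strictly earlier.
-- (Every finite rooted tree admits such a numbering, e.g. BFS order.)

record RootedTree : Set where
  field
    m       : ℕ
    parent  : Fin m → Fin (suc m)
    parent< : ∀ i → toℕ (parent i) ≤ toℕ i

  Node : Set
  Node = Fin (suc m)

  IsParentOf : Node → Node → Set
  IsParentOf zero    s = ⊥
  IsParentOf (suc i) s = parent i ≡ s

  TAdj : Node → Node → Set
  TAdj t s = IsParentOf t s ⊎ IsParentOf s t

  data WalkIn (S : Node → Set) : Node → Node → Set where
    here : ∀ {a} → S a → WalkIn S a a
    step : ∀ {a b c} → S a → TAdj a b → WalkIn S b c → WalkIn S a c

record TreeDecomposition {n : ℕ} (G : Fin n → Fin n → Set) : Set₁ where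
  field
    T : RootedTree
  open RootedTree T public
  field
    β        : Node → Subset n
    cover-v  : ∀ v → ∃[ t ] (v ∈ β t)
    cover-e  : ∀ u v → G u v → ∃[ t ] (u ∈ β t × v ∈ β t)
    connected : ∀ v a b → v ∈ β a → v ∈ β b → WalkIn (λ t → v ∈ β t) a b

  σ : Node → Subset n
  σ zero    = ∅
  σ (suc i) = β (suc i) ∩ β (parent i)

TreewidthAtMost : {n : ℕ} → (Fin n → Fin n → Set) → ℕ → Set₁
TreewidthAtMost G w =
  Σ (TreeDecomposition G) λ D → ∀ t → ∣ TreeDecomposition.β D t ∣ ≤ suc w

-- Paths of length ≥ 1 (i.e. at least two, pairwise distinct, vertices).
-- A path with ℓ+1 edges is an injective map p : Fin (suc (suc ℓ)) → Fin n
-- with consecutive vertices adjacent; its endpoints are p zero and p (fromℕ _).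

record PathIn {n : ℕ} (G : Fin n → Fin n → Set) : Set where
  field
    ℓ     : ℕ
    p     : Fin (suc (suc ℓ)) → Fin n
    inj   : ∀ a b → p a ≡ p b → a ≡ b
    adj   : ∀ (j : Fin (suc ℓ)) → G (p (inject₁ j)) (p (suc j))

  start : Fin n
  start = p zero

  end : Fin n
  end = p (fromℕ (suc ℓ))

record Flower (H : ColoredGraph) (c : ℕ) (i : Fin (ColoredGraph.k H)) : Set where
  open ColoredGraph H
  field
    path      : Fin c → PathIn (AdjBulletExcept i)
    start-col : ∀ r → col (PathIn.start (path r)) ≡ i
    end-col   : ∀ r → col (PathIn.end (path r)) ≡ i
    disjoint  : ∀ r r' → r ≢ r' → ∀ a b →
                PathIn.p (path r) a ≢ PathIn.p (path r') b

record GuardedCutvertexDecomposition (H : ColoredGraph) : Set₁ where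
  open ColoredGraph H
  field
    TD : TreeDecomposition AdjBullet
  open TreeDecomposition TD public
  field
    g     : Node → Subset n
    σ⊆g   : ∀ t → σ t ⊆ g t
    g⊆β   : ∀ t → g t ⊆ β t
    cover : ∀ t u v → Adj u v → u ∈ β t → v ∈ β t → u ∈ g t ⊎ v ∈ g t
    child : ∀ i → ∣ σ (suc i) ─ g (parent i) ∣ ≤ 1

  colorsIn : Node → ℕ
  colorsIn t = ∣ tabulate (λ j → does (any? (λ u → (u ∈? β t) ×-dec (col u ≟ j)))) ∣

{-# OPTIONS --safe #-}

-- For each color i, let S i hit all C_i-paths of H^{•∖i}; |S i| ≤ 4c suffices by a weak form of
-- Gallai's theorem.  To see this, grow disjoint pieces, each a C_i-path or a subdivided claw with
-- its three leaves in C_i.  A C_i-path avoiding the leaves and the branch vertices either is a new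
-- piece, or its initial segment turns a path into a claw, or a claw into two paths; each time the
-- number of leaves grows.  With fewer than c pieces the leaves and branch vertices number at most 4c.
--
-- Let B be a bag of the tree decomposition of Ĥ and C_B the union of its classes.  For i ≠ j in B
-- at most one vertex of C_i is joined to C_j in H^{•∖i} − S i, because C_j is a clique there.
-- Adding these vertices to the sets S i, i ∈ B, gives a set core B of O((c + w) w) vertices that
-- covers the edges of H[C_B], and every component of H^• − C_B − core B has at most one
-- neighbor in C_B ∖ core B.
--
-- The decomposition is grown from an empty root.  While a vertex x is in no bag, let D be its
-- component outside the bags and X = N(D), which lies in one bag.  Choose B balanced for X, i.e.
-- every component of H^• − C_B meets or sees at most half of X outside C_B, and add the bag
-- X ∪ (D ∩ (C_B ∪ core B ∪ {x})) with guard X ∪ (D ∩ (core B ∪ {x})).  Balance keeps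
-- |X| ≤ 2 |core B| + O(1) for the components of the rest of D.
module Submission where

open import Defs
open import Data.Nat using (ℕ; zero; suc; _≤_; _<_; _+_; _*_; _^_; >-nonZero; z≤n; s≤s; _≤?_)
import Data.Nat.Properties as ℕ
open import Data.Bool using (true)
import Data.Bool as Bool
open import Data.Fin using (Fin; zero; suc; toℕ; inject₁; fromℕ; inject≤; _≟_)
import Data.Fin.Properties as Fin
open import Data.Fin.Properties using (any?)
open import Data.Fin.Subset
  using (Subset; inside; outside; _∈_; _∉_; _⊆_; _∩_; _∪_; _─_; _-_; ∁; ⁅_⁆; ∣_∣) renaming (⊥ to ∅)
open import Data.Fin.Subset.Properties
open import Data.Fin.Relation.Unary.Top using (view; ‵fromℕ; ‵inject₁)
open import Data.Vec using (tabulate; []; _∷_)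
import Data.Vec as Vec
import Data.Vec.Properties as Vec
open import Data.List using (List; []; _∷_; _++_; length; concatMap)
import Data.List as List
open import Data.List.Membership.Propositional using () renaming (_∈_ to _∈ˡ_; _∉_ to _∉ˡ_)
open import Data.List.Membership.Propositional.Properties
  using (∈-++⁺ˡ; ∈-++⁺ʳ; ∈-++⁻; ∈-lookup)
import Data.List.Membership.DecPropositional as DecMembership
open import Data.List.Relation.Unary.Any using (here; there)
open import Data.List.Relation.Unary.All as All using (All; []; _∷_)
open import Data.List.Relation.Unary.AllPairs as AllPairs using (AllPairs; []; _∷_)
import Data.List.Relation.Unary.AllPairs.Properties as AllPairs
open import Data.List.Relation.Binary.Disjoint.Propositional using (Disjoint)
open import Data.List.Relation.Binary.Disjoint.Propositional.Properties
  using () renaming (sym to Disjoint-sym)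
open import Data.Product using (Σ; ∃-syntax; _×_; _,_; proj₁; proj₂)
open import Data.Sum using (_⊎_; inj₁; inj₂; [_,_]′)
open import Data.Empty using (⊥; ⊥-elim)
open import Data.Unit using (⊤; tt)
open import Function using (_∘_; id)
open import Relation.Nullary using (¬_; Dec; yes; no; contradiction)
open import Relation.Nullary.Decidable using (does; decidable-stable; dec-true; _×-dec_; _⊎-dec_; ¬?; map′)
open import Relation.Binary.PropositionalEquality
  using (_≡_; _≢_; refl; sym; trans; cong; subst; subst₂)
open import Data.Nat.Tactic.RingSolver using (solve-∀)

-- Finite subsets: comprehension, cardinality and bounded unions

opaque

  select : ∀ {n} {P : Fin n → Set} → (∀ x → Dec (P x)) → Subset n
  select P? = tabulate (does ∘ P?)

  ∈-select⁺ : ∀ {n} {P : Fin n → Set} (P? : ∀ x → Dec (P x)) {x} → P x → x ∈ select P?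
  ∈-select⁺ P? {x} px = Vec.lookup⇒[]= x (select P?)
    (trans (Vec.lookup∘tabulate (does ∘ P?) x) (dec-true (P? x) px))

  ∈-select⁻ : ∀ {n} {P : Fin n → Set} (P? : ∀ x → Dec (P x)) {x} → x ∈ select P? → P x
  ∈-select⁻ P? {x} x∈ with P? x in eq
  ... | yes px = px
  ... | no ¬px = contradiction
    (trans (sym (Vec.[]=⇒lookup x∈)) (trans (Vec.lookup∘tabulate (does ∘ P?) x) (cong does eq))) λ ()

x∈p─q⇒x∉q : ∀ {n} (p q : Subset n) {x} → x ∈ p ─ q → x ∉ q
x∈p─q⇒x∉q (inside ∷ p)  (outside ∷ q) Vec.here       ()
x∈p─q⇒x∉q (_ ∷ p)       (outside ∷ q) (Vec.there x∈) (Vec.there x∈q) = x∈p─q⇒x∉q p q x∈ x∈q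
x∈p─q⇒x∉q (_ ∷ p)       (inside ∷ q)  (Vec.there x∈) (Vec.there x∈q) = x∈p─q⇒x∉q p q x∈ x∈q

∣∣-mono : ∀ {n} (p q : Subset n) → (∀ {x} → x ∈ p → x ∈ q) → ∣ p ∣ ≤ ∣ q ∣
∣∣-mono p q p⊆q = p⊆q⇒∣p∣≤∣q∣ {p = p} {q} p⊆q

∣p∪q∣≤∣p∣+∣q∣ : ∀ {n} (p q : Subset n) → ∣ p ∪ q ∣ ≤ ∣ p ∣ + ∣ q ∣
∣p∪q∣≤∣p∣+∣q∣ []            []            = z≤n
∣p∪q∣≤∣p∣+∣q∣ (outside ∷ p) (outside ∷ q) = ∣p∪q∣≤∣p∣+∣q∣ p q
∣p∪q∣≤∣p∣+∣q∣ (outside ∷ p) (inside ∷ q)  =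
  ℕ.≤-trans (s≤s (∣p∪q∣≤∣p∣+∣q∣ p q)) (ℕ.≤-reflexive (sym (ℕ.+-suc ∣ p ∣ ∣ q ∣)))
∣p∪q∣≤∣p∣+∣q∣ (inside ∷ p)  (outside ∷ q) = s≤s (∣p∪q∣≤∣p∣+∣q∣ p q)
∣p∪q∣≤∣p∣+∣q∣ (inside ∷ p)  (inside ∷ q)  =
  s≤s (ℕ.≤-trans (∣p∪q∣≤∣p∣+∣q∣ p q) (ℕ.+-monoʳ-≤ ∣ p ∣ (ℕ.n≤1+n ∣ q ∣)))

∣p∣≡∣p∩q∣+∣p─q∣ : ∀ {n} (p q : Subset n) → ∣ p ∣ ≡ ∣ p ∩ q ∣ + ∣ p ─ q ∣
∣p∣≡∣p∩q∣+∣p─q∣ []            []            = refl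
∣p∣≡∣p∩q∣+∣p─q∣ (outside ∷ p) (outside ∷ q) = ∣p∣≡∣p∩q∣+∣p─q∣ p q
∣p∣≡∣p∩q∣+∣p─q∣ (outside ∷ p) (inside ∷ q)  = ∣p∣≡∣p∩q∣+∣p─q∣ p q
∣p∣≡∣p∩q∣+∣p─q∣ (inside ∷ p)  (outside ∷ q) =
  trans (cong suc (∣p∣≡∣p∩q∣+∣p─q∣ p q)) (sym (ℕ.+-suc ∣ p ∩ q ∣ ∣ p ─ q ∣))
∣p∣≡∣p∩q∣+∣p─q∣ (inside ∷ p)  (inside ∷ q)  = cong suc (∣p∣≡∣p∩q∣+∣p─q∣ p q)

subsingleton⇒∣p∣≤1 : ∀ {n} (p : Subset n) → (∀ {x y} → x ∈ p → y ∈ p → x ≡ y) → ∣ p ∣ ≤ 1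
subsingleton⇒∣p∣≤1 {n} p h with nonempty? p
... | yes (x , x∈p) = ℕ.≤-trans (∣∣-mono p ⁅ x ⁆ λ y∈p → subst (_∈ ⁅ x ⁆) (h x∈p y∈p) (x∈⁅x⁆ x))
                                (ℕ.≤-reflexive (∣⁅x⁆∣≡1 x))
... | no ¬x = ℕ.≤-trans (∣∣-mono p ∅ λ {y} y∈p → ⊥-elim (¬x (y , y∈p)))
                        (ℕ.≤-trans (ℕ.≤-reflexive (∣⊥∣≡0 n)) z≤n)

opaque

  ⋃⟨_⟩ : ∀ {k n} → Subset k → (Fin k → Subset n) → Subset n
  ⋃⟨ B ⟩ F = select λ x → any? λ i → i ∈? B ×-dec x ∈? F i

  ∈-⋃⁺ : ∀ {k n} {B : Subset k} {F : Fin k → Subset n} {i x} → i ∈ B → x ∈ F i → x ∈ ⋃⟨ B ⟩ F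
  ∈-⋃⁺ {B = B} {F} {i} i∈ x∈ = ∈-select⁺ (λ x → any? λ i → i ∈? B ×-dec x ∈? F i) (i , i∈ , x∈)

  ∈-⋃⁻ : ∀ {k n} (B : Subset k) (F : Fin k → Subset n) {x} →
         x ∈ ⋃⟨ B ⟩ F → ∃[ i ] (i ∈ B × x ∈ F i)
  ∈-⋃⁻ B F = ∈-select⁻ (λ x → any? λ i → i ∈? B ×-dec x ∈? F i)

∣⋃∣≤ : ∀ {k n M} (B : Subset k) (F : Fin k → Subset n) →
      (∀ {i} → i ∈ B → ∣ F i ∣ ≤ M) → ∣ ⋃⟨ B ⟩ F ∣ ≤ ∣ B ∣ * M
∣⋃∣≤ {n = n} [] F h = ℕ.≤-trans (∣∣-mono (⋃⟨ [] ⟩ F) ∅ (⊥-elim ∘ empty)) (ℕ.≤-reflexive (∣⊥∣≡0 n))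
  where
  empty : ∀ {x} → x ∈ ⋃⟨ [] ⟩ F → ⊥
  empty x∈ with ∈-⋃⁻ [] F x∈
  ... | () , _
∣⋃∣≤ (outside ∷ B) F h = ℕ.≤-trans (∣∣-mono (⋃⟨ outside ∷ B ⟩ F) (⋃⟨ B ⟩ (F ∘ suc)) shrink)
  (∣⋃∣≤ B (F ∘ suc) (h ∘ Vec.there))
  where
  shrink : ∀ {x} → x ∈ ⋃⟨ outside ∷ B ⟩ F → x ∈ ⋃⟨ B ⟩ (F ∘ suc)
  shrink x∈ with ∈-⋃⁻ (outside ∷ B) F x∈
  ... | suc i , Vec.there i∈ , x∈F = ∈-⋃⁺ i∈ x∈F
∣⋃∣≤ (inside ∷ B) F h =
  ℕ.≤-trans (∣∣-mono (⋃⟨ inside ∷ B ⟩ F) (F zero ∪ ⋃⟨ B ⟩ (F ∘ suc)) shrink)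
  (ℕ.≤-trans (∣p∪q∣≤∣p∣+∣q∣ (F zero) _)
             (ℕ.+-mono-≤ (h Vec.here) (∣⋃∣≤ B (F ∘ suc) (h ∘ Vec.there))))
  where
  shrink : ∀ {x} → x ∈ ⋃⟨ inside ∷ B ⟩ F → x ∈ F zero ∪ ⋃⟨ B ⟩ (F ∘ suc)
  shrink x∈ with ∈-⋃⁻ (inside ∷ B) F x∈
  ... | zero  , _            , x∈F = x∈p∪q⁺ (inj₁ x∈F)
  ... | suc i , Vec.there i∈ , x∈F = x∈p∪q⁺ {p = F zero} (inj₂ (∈-⋃⁺ i∈ x∈F))

fromList : ∀ {n} → List (Fin n) → Subset n
fromList []       = ∅
fromList (x ∷ xs) = ⁅ x ⁆ ∪ fromList xs

∈-fromList : ∀ {n} {x : Fin n} {xs} → x ∈ˡ xs → x ∈ fromList xs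
∈-fromList {x = x} (here refl) = x∈p∪q⁺ (inj₁ (x∈⁅x⁆ x))
∈-fromList {xs = y ∷ _} (there x∈) = x∈p∪q⁺ {p = ⁅ y ⁆} (inj₂ (∈-fromList x∈))

∣fromList∣≤length : ∀ {n} (xs : List (Fin n)) → ∣ fromList xs ∣ ≤ length xs
∣fromList∣≤length {n} [] = ℕ.≤-reflexive (∣⊥∣≡0 n)
∣fromList∣≤length (x ∷ xs) = ℕ.≤-trans (∣p∪q∣≤∣p∣+∣q∣ ⁅ x ⁆ _)
  (ℕ.+-mono-≤ (ℕ.≤-reflexive (∣⁅x⁆∣≡1 x)) (∣fromList∣≤length xs))

-- Reachability avoiding a set of vertices

data Reach {n : ℕ} (G : Fin n → Fin n → Set) (Z : Subset n) : Fin n → Fin n → Set where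
  stop : ∀ {x} → x ∉ Z → Reach G Z x x
  go   : ∀ {x y z} → x ∉ Z → G x y → Reach G Z y z → Reach G Z x z

module _ {n : ℕ} {G : Fin n → Fin n → Set} where

  reach-source : ∀ {Z x y} → Reach G Z x y → x ∉ Z
  reach-source (stop x∉)   = x∉
  reach-source (go x∉ _ _) = x∉

  reach-target : ∀ {Z x y} → Reach G Z x y → y ∉ Z
  reach-target (stop x∉)  = x∉
  reach-target (go _ _ r) = reach-target r

  reach-trans : ∀ {Z x y z} → Reach G Z x y → Reach G Z y z → Reach G Z x z
  reach-trans (stop _)    s = s
  reach-trans (go x∉ e r) s = go x∉ e (reach-trans r s)

  reach-edge : ∀ {Z x y} → x ∉ Z → y ∉ Z → G x y → Reach G Z x y
  reach-edge x∉ y∉ e = go x∉ e (stop y∉)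

  reach-sym : (∀ {x y} → G x y → G y x) → ∀ {Z x y} → Reach G Z x y → Reach G Z y x
  reach-sym G-sym (stop x∉)   = stop x∉
  reach-sym G-sym (go x∉ e r) =
    reach-trans (reach-sym G-sym r) (reach-edge (reach-source r) x∉ (G-sym e))

  reach-antitone : ∀ {Z Z′ x y} → Z′ ⊆ Z → Reach G Z x y → Reach G Z′ x y
  reach-antitone Z′⊆Z (stop x∉)   = stop (x∉ ∘ Z′⊆Z)
  reach-antitone Z′⊆Z (go x∉ e r) = go (x∉ ∘ Z′⊆Z) e (reach-antitone Z′⊆Z r)

  private
    OneStep : Subset n → Fin n → Fin n → Set
    OneStep Z x z = x ≡ z ⊎ ∃[ y ] (G x y × Reach G (Z ∪ ⁅ x ⁆) y z)

    ∉-∪⁅⁆ : ∀ {Z : Subset n} {x y} → y ∉ Z → x ≢ y → y ∉ Z ∪ ⁅ x ⁆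
    ∉-∪⁅⁆ {Z} {x} y∉ x≢y y∈ with x∈p∪q⁻ Z ⁅ x ⁆ y∈
    ... | inj₁ y∈Z = y∉ y∈Z
    ... | inj₂ y∈x = x≢y (sym (x∈⁅y⁆⇒x≡y _ y∈x))

    -- Cut a walk after its last visit of x.
    last-visit : ∀ {Z} x {y z} → Reach G Z y z → Reach G (Z ∪ ⁅ x ⁆) y z ⊎ OneStep Z x z
    last-visit x {y} (stop y∉) with x ≟ y
    ... | yes x≡y = inj₂ (inj₁ x≡y)
    ... | no  x≢y = inj₁ (stop (∉-∪⁅⁆ y∉ x≢y))
    last-visit x {y} (go y∉ e r) with last-visit x r
    ... | inj₂ s = inj₂ s
    ... | inj₁ r′ with x ≟ y
    ...   | yes refl = inj₂ (inj₂ (_ , e , r′))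
    ...   | no  x≢y  = inj₁ (go (∉-∪⁅⁆ y∉ x≢y) e r′)

  module _ (G? : ∀ x y → Dec (G x y)) where

    private
      -- A walk can be shortened so that it never returns to its source, so the source may join the
      -- forbidden set after one step. The complement of that set shrinks, and its size is the
      -- measure of the search.
      reach-fuel : ∀ f Z → ∣ ∁ Z ∣ < f → ∀ x z → Dec (Reach G Z x z)
      reach-fuel (suc f) Z (s≤s ∣∁Z∣≤f) x z with x ∈? Z
      ... | yes x∈ = no λ r → reach-source r x∈
      ... | no  x∉ = map′ join split
              (x ≟ z ⊎-dec any? λ y → G? x y ×-dec reach-fuel f (Z ∪ ⁅ x ⁆) smaller y z)
        where
        smaller : ∣ ∁ (Z ∪ ⁅ x ⁆) ∣ < f
        smaller = ℕ.<-≤-trans (p⊂q⇒∣p∣<∣q∣ (p⊂q⇒∁p⊃∁q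
          (p⊆p∪q ⁅ x ⁆ , x , x∈p∪q⁺ {p = Z} (inj₂ (x∈⁅x⁆ x)) , x∉))) ∣∁Z∣≤f
        join : OneStep Z x z → Reach G Z x z
        join (inj₁ refl)        = stop x∉
        join (inj₂ (y , e , r)) = go x∉ e (reach-antitone (p⊆p∪q ⁅ x ⁆) r)
        split : Reach G Z x z → OneStep Z x z
        split r with last-visit x r
        ... | inj₁ r′ = ⊥-elim (reach-source r′ (x∈p∪q⁺ {p = Z} (inj₂ (x∈⁅x⁆ x))))
        ... | inj₂ s  = s

    opaque

      reach? : ∀ Z x z → Dec (Reach G Z x z)
      reach? Z = reach-fuel (suc ∣ ∁ Z ∣) Z ℕ.≤-refl

-- Packing paths between terminals

module Packing {n : ℕ} (G : Fin n → Fin n → Set) (G-sym : ∀ {x y} → G x y → G y x)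
               (G? : ∀ x y → Dec (G x y))
               (A : Fin n → Set) (A? : ∀ x → Dec (A x)) where

  open DecMembership (_≟_ {n}) using () renaming (_∈?_ to _∈ˡ?_)

  -- Walks, reversal and loop erasure

  infixr 5 _++ʷ_

  -- The list holds the vertices of the walk except the last one.
  data Walk : Fin n → Fin n → List (Fin n) → Set where
    []  : ∀ {a} → Walk a a []
    _∷_ : ∀ {a b c l} → G a b → Walk b c l → Walk a c (a ∷ l)

  _++ʷ_ : ∀ {a b c l m} → Walk a b l → Walk b c m → Walk a c (l ++ m)
  []      ++ʷ w′ = w′
  (e ∷ w) ++ʷ w′ = e ∷ (w ++ʷ w′)

  source∈ : ∀ {a b l} → Walk a b l → a ∈ˡ b ∷ l
  source∈ []      = here refl
  source∈ (_ ∷ _) = there (here refl)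

  private
    ∷-skip : ∀ {b a x : Fin n} {l} → x ∈ˡ b ∷ l → x ∈ˡ b ∷ a ∷ l
    ∷-skip (here refl) = here refl
    ∷-skip (there x∈)  = there (there x∈)

  -- Reversal with an accumulator. A walk leaves its last vertex unlisted, so reversing changes
  -- which end is listed; hence `b ∷ l` and not `l` in the containment.
  reverseOnto : ∀ {c b y l acc} → Walk c b l → Walk c y acc →
                ∃[ m ] (Walk b y m × (∀ {x} → x ∈ˡ m → x ∈ˡ b ∷ l ⊎ x ∈ˡ acc))
  reverseOnto [] w′ = _ , w′ , inj₂
  reverseOnto {b = b} (_∷_ {a} {l = l} e w) w′ with reverseOnto w (G-sym e ∷ w′)
  ... | m , r , m⊆ = m , r , λ x∈ → relocate (m⊆ x∈)
    where
    relocate : ∀ {x acc} → x ∈ˡ b ∷ l ⊎ x ∈ˡ _ ∷ acc → x ∈ˡ b ∷ a ∷ l ⊎ x ∈ˡ acc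
    relocate (inj₁ x∈)          = inj₁ (∷-skip x∈)
    relocate (inj₂ (here refl)) = inj₁ (∷-skip (source∈ w))
    relocate (inj₂ (there x∈))  = inj₂ x∈

  Simple : Fin n → List (Fin n) → Set
  Simple b []      = ⊤
  Simple b (a ∷ l) = a ∉ˡ b ∷ l × Simple b l

  private
    ∷-mono : ∀ {b a : Fin n} {l m} → (∀ {x} → x ∈ˡ b ∷ l → x ∈ˡ b ∷ m) →
             ∀ {x} → x ∈ˡ b ∷ a ∷ l → x ∈ˡ b ∷ a ∷ m
    ∷-mono l⊆m (here refl)         = here refl
    ∷-mono l⊆m (there (here refl)) = there (here refl)
    ∷-mono l⊆m (there (there x∈))  = ∷-skip (l⊆m (there x∈))

  SimpleWithin : Fin n → Fin n → List (Fin n) → Set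
  SimpleWithin a b l = ∃[ m ] (Walk a b m × Simple b m × (∀ {x} → x ∈ˡ b ∷ m → x ∈ˡ b ∷ l))

  suffix : ∀ {a b c l} → Walk b c l → Simple c l → a ∈ˡ l → SimpleWithin a c l
  suffix (e ∷ w) s       (here refl) = _ , e ∷ w , s , id
  suffix (e ∷ w) (_ , s) (there a∈) with suffix w s a∈
  ... | m , w′ , s′ , m⊆ = m , w′ , s′ , ∷-skip ∘ m⊆

  -- Loop erasure from the back: if the source occurs again on the already simple remainder, the
  -- walk is replaced by the suffix that starts there.
  erase : ∀ {a b l} → Walk a b l → SimpleWithin a b l
  erase [] = [] , [] , tt , id
  erase {a} {b} (e ∷ w) with erase w
  ... | m , w′ , s′ , m⊆ with a ∈ˡ? (b ∷ m)
  ...   | no  a∉          = a ∷ m , e ∷ w′ , (a∉ , s′) , ∷-mono m⊆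
  ...   | yes (here refl) = [] , [] , tt , λ { (here refl) → here refl }
  ...   | yes (there a∈) with suffix w′ s′ a∈
  ...     | m′ , w″ , s″ , m′⊆ = m′ , w″ , s″ , ∷-skip ∘ m⊆ ∘ m′⊆

  prefix : ∀ {a b x l} → Walk a b l → x ∈ˡ l → ∃[ m ] (Walk a x m × (∀ {z} → z ∈ˡ m → z ∈ˡ l))
  prefix (e ∷ w) (here refl) = [] , [] , λ ()
  prefix (e ∷ w) (there x∈) with prefix w x∈
  ... | m , w′ , m⊆ = _ ∷ m , e ∷ w′ , λ { (here refl) → here refl ; (there z∈) → there (m⊆ z∈) }

  -- This prepares two arms of a claw with branch vertex `x`. The second half is reversed so that
  -- both run from a terminal towards `x`; simplicity makes them disjoint.
  splitSimple : ∀ {a b x l} → Walk a b l → Simple b l → x ∈ˡ l →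
    ∃[ p ] ∃[ q ] (Walk a x p × Walk b x q × x ∉ˡ p × x ∉ˡ q × Disjoint p q ×
                   (∀ {z} → z ∈ˡ p → z ∈ˡ l) × (∀ {z} → z ∈ˡ q → z ∈ˡ b ∷ l))
  splitSimple {a} {b} (e ∷ w) (a∉ , _) (here refl) with reverseOnto w (G-sym e ∷ [])
  ... | q , w′ , q⊆ = [] , q , [] , w′ , (λ ()) , a∉ ∘ within , (λ { (() , _) }) , (λ ()) , ∷-skip ∘ within
    where
    within : ∀ {z} → z ∈ˡ q → z ∈ˡ b ∷ _
    within z∈ with q⊆ z∈
    ... | inj₁ z∈l         = z∈l
    ... | inj₂ (here refl) = source∈ w
  splitSimple {a} (e ∷ w) (a∉ , s) (there x∈) with splitSimple w s x∈
  ... | p , q , wp , wq , x∉p , x∉q , p⟂q , p⊆ , q⊆ =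
    a ∷ p , q , e ∷ wp , wq ,
    (λ { (here refl) → a∉ (there x∈) ; (there x∈p) → x∉p x∈p }) , x∉q ,
    (λ { (here refl , a∈q) → a∉ (q⊆ a∈q) ; (there z∈p , z∈q) → p⟂q (z∈p , z∈q) }) ,
    (λ { (here refl) → here refl ; (there z∈) → there (p⊆ z∈) }) , ∷-skip ∘ q⊆

  firstHit : {P : Fin n → Set} (P? : ∀ x → Dec (P x)) → ∀ {a b l} → Walk a b l →
    (∀ {x} → x ∈ˡ b ∷ l → ¬ P x) ⊎
    ∃[ y ] ∃[ m ] (P y × y ∈ˡ b ∷ l × Walk a y m × (∀ {x} → x ∈ˡ m → ¬ P x))
  firstHit P? {a} [] with P? a
  ... | yes pa = inj₂ (a , [] , pa , here refl , [] , λ ())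
  ... | no ¬pa = inj₁ λ { (here refl) → ¬pa }
  firstHit P? {a} (e ∷ w) with P? a
  ... | yes pa = inj₂ (a , [] , pa , there (here refl) , [] , λ ())
  ... | no ¬pa with firstHit P? w
  ...   | inj₁ ¬P = inj₁ λ { (here refl)         → ¬P (here refl)
                           ; (there (here refl)) → ¬pa
                           ; (there (there x∈))  → ¬P (there x∈) }
  ...   | inj₂ (y , m , py , y∈ , w′ , ¬P) =
    inj₂ (y , a ∷ m , py , ∷-skip y∈ , e ∷ w′ , λ { (here refl) → ¬pa ; (there x∈) → ¬P x∈ })

  reach⇒walk : ∀ {Z a b} → Reach G Z a b → ∃[ l ] (Walk a b l × (∀ {x} → x ∈ˡ b ∷ l → x ∉ Z))
  reach⇒walk (stop a∉) = [] , [] , λ { (here refl) → a∉ }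
  reach⇒walk (go a∉ e r) with reach⇒walk r
  ... | l , w , l∉ = _ ∷ l , e ∷ w , λ { (here refl)         → l∉ (here refl)
                                       ; (there (here refl)) → a∉
                                       ; (there (there x∈))  → l∉ (there x∈) }

  -- Paths between terminals, claws, and their replacement

  record APath : Set where
    field
      {a b} : Fin n
      {l}   : List (Fin n)
      Aa    : A a
      Ab    : A b
      a≢b   : a ≢ b
      walk  : Walk a b l
      simple : Simple b l
    vertices : List (Fin n)
    vertices = b ∷ l

  -- The two walks may intersect: their concatenation through `u` is loop-erased, and only the
  -- containment of vertex sets matters later.
  join : ∀ {a b u l m} → A a → A b → a ≢ b → Walk a u l → Walk b u m →
         Σ APath λ P → ∀ {x} → x ∈ˡ APath.vertices P → x ∈ˡ u ∷ l ++ m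
  join {a} {b} {u} {l} {m} Aa Ab a≢b w w′ with reverseOnto w′ []
  ... | m′ , r , m′⊆ with erase (w ++ʷ r)
  ...   | k , v , s , k⊆ =
    record { Aa = Aa ; Ab = Ab ; a≢b = a≢b ; walk = v ; simple = s } , relocate ∘ k⊆
    where
    into : ∀ {x} → x ∈ˡ u ∷ m → x ∈ˡ u ∷ l ++ m
    into (here refl) = here refl
    into (there x∈)  = there (∈-++⁺ʳ l x∈)
    relocate : ∀ {x} → x ∈ˡ b ∷ l ++ m′ → x ∈ˡ u ∷ l ++ m
    relocate (here refl) = into (source∈ w′)
    relocate (there x∈) with ∈-++⁻ l x∈
    ... | inj₁ x∈l = there (∈-++⁺ˡ x∈l)
    ... | inj₂ x∈m′ with m′⊆ x∈m′
    ...   | inj₁ x∈ = into x∈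

  -- A subdivided claw with branch vertex `u`. The arms do not list `u`, so their disjointness is
  -- plain list disjointness. They need not be simple, since `join` erases loops, and an arm is
  -- empty when its terminal is `u` itself.
  record Tripod : Set where
    field
      {u a₁ a₂ a₃} : Fin n
      {l₁ l₂ l₃}   : List (Fin n)
      A₁ : A a₁
      A₂ : A a₂
      A₃ : A a₃
      a₁≢a₂ : a₁ ≢ a₂
      a₁≢a₃ : a₁ ≢ a₃
      a₂≢a₃ : a₂ ≢ a₃
      w₁ : Walk a₁ u l₁
      w₂ : Walk a₂ u l₂
      w₃ : Walk a₃ u l₃
      u∉l₁ : u ∉ˡ l₁
      u∉l₂ : u ∉ˡ l₂
      u∉l₃ : u ∉ˡ l₃
      l₁⟂l₂ : Disjoint l₁ l₂
      l₁⟂l₃ : Disjoint l₁ l₃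
      l₂⟂l₃ : Disjoint l₂ l₃
    vertices : List (Fin n)
    vertices = u ∷ l₁ ++ l₂ ++ l₃

  data Piece : Set where
    path   : APath → Piece
    tripod : Tripod → Piece

  verts hitting : Piece → List (Fin n)
  verts (path P)   = APath.vertices P
  verts (tripod T) = Tripod.vertices T
  hitting (path P)    = let open APath P in a ∷ b ∷ []
  hitting (tripod T)  = let open Tripod T in u ∷ a₁ ∷ a₂ ∷ a₃ ∷ []

  leaves : Piece → ℕ
  leaves (path _)   = 2
  leaves (tripod _) = 3

  _⟂_ : Piece → Piece → Set
  P ⟂ Q = Disjoint (verts P) (verts Q)

  leafCount : List Piece → ℕ
  leafCount []       = 0
  leafCount (P ∷ Ps) = leaves P + leafCount Ps

  pieceToPath : (P : Piece) → Σ APath λ Q → ∀ {x} → x ∈ˡ APath.vertices Q → x ∈ˡ verts P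
  pieceToPath (path P)   = P , id
  pieceToPath (tripod T) with join A₁ A₂ a₁≢a₂ w₁ w₂
    where open Tripod T
  ... | Q , Q⊆ = Q , λ x∈ → widen (Q⊆ x∈)
    where
    open Tripod T
    widen : ∀ {x} → x ∈ˡ u ∷ l₁ ++ l₂ → x ∈ˡ u ∷ l₁ ++ l₂ ++ l₃
    widen (here refl) = here refl
    widen (there x∈) with ∈-++⁻ l₁ x∈
    ... | inj₁ x∈₁ = there (∈-++⁺ˡ x∈₁)
    ... | inj₂ x∈₂ = there (∈-++⁺ʳ l₁ (∈-++⁺ˡ x∈₂))

  -- The replacement gains exactly one leaf: a path (2) becomes a claw (3), a claw (3) becomes two
  -- paths (4). Staying within `P` and the new arm `N` keeps it disjoint from all other pieces.
  Attached : Piece → List (Fin n) → Set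
  Attached P N = ∃[ Ps ] (leafCount Ps ≡ suc (leaves P) × AllPairs _⟂_ Ps ×
                         (∀ {Q x} → Q ∈ˡ Ps → x ∈ˡ verts Q → x ∈ˡ verts P ⊎ x ∈ˡ N))

  -- An arm attached inside arm 1 of a tripod cuts it into two disjoint paths.
  cutArm : ∀ {u a₁ a₂ a₃ l₁ l₂ l₃ a y N} → A a₁ → A a₂ → A a₃ → a₂ ≢ a₃ →
    Walk a₁ u l₁ → Walk a₂ u l₂ → Walk a₃ u l₃ →
    u ∉ˡ l₁ → Disjoint l₁ l₂ → Disjoint l₁ l₃ →
    y ∈ˡ l₁ → A a → a₁ ≢ a → Walk a y N →
    u ∉ˡ N → Disjoint N l₂ → Disjoint N l₃ →
    Σ APath λ P → Σ APath λ Q → Disjoint (APath.vertices P) (APath.vertices Q) ×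
      (∀ {x} → x ∈ˡ APath.vertices P → x ∈ˡ l₁ ⊎ x ∈ˡ N) ×
      (∀ {x} → x ∈ˡ APath.vertices Q → x ∈ˡ u ∷ l₂ ++ l₃)
  cutArm {u} {l₁ = l₁} {l₂} {l₃} {y = y} {N} A₁ A₂ A₃ a₂≢a₃ w₁ w₂ w₃ u∉l₁ l₁⟂l₂ l₁⟂l₃
         y∈ Aa a₁≢a w u∉N N⟂l₂ N⟂l₃ with prefix w₁ y∈
  ... | m , v , m⊆ with join A₁ Aa a₁≢a v w | join A₂ A₃ a₂≢a₃ w₂ w₃
  ...   | P , P⊆ | Q , Q⊆ = P , Q , (λ { (x∈P , x∈Q) → apart (P⊆′ x∈P) (Q⊆ x∈Q) }) , P⊆′ , Q⊆
    where
    P⊆′ : ∀ {x} → x ∈ˡ APath.vertices P → x ∈ˡ l₁ ⊎ x ∈ˡ N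
    P⊆′ x∈ with P⊆ x∈
    ... | here refl = inj₁ y∈
    ... | there x∈m++N with ∈-++⁻ m x∈m++N
    ...   | inj₁ x∈m = inj₁ (m⊆ x∈m)
    ...   | inj₂ x∈N = inj₂ x∈N
    apart : ∀ {x} → x ∈ˡ l₁ ⊎ x ∈ˡ N → x ∈ˡ u ∷ l₂ ++ l₃ → ⊥
    apart (inj₁ x∈) (here refl) = u∉l₁ x∈
    apart (inj₂ x∈) (here refl) = u∉N x∈
    apart x∈        (there x∈′) with ∈-++⁻ l₂ x∈′
    apart (inj₁ x∈) _ | inj₁ x∈₂ = l₁⟂l₂ (x∈ , x∈₂)
    apart (inj₂ x∈) _ | inj₁ x∈₂ = N⟂l₂ (x∈ , x∈₂)
    apart (inj₁ x∈) _ | inj₂ x∈₃ = l₁⟂l₃ (x∈ , x∈₃)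
    apart (inj₂ x∈) _ | inj₂ x∈₃ = N⟂l₃ (x∈ , x∈₃)

  -- As `y` is no hitting vertex, it lies strictly inside a path or an arm; as `a` is none, it
  -- differs from the present leaves. The three arms of a claw are treated alike by permuting the
  -- arguments of `cutArm`.
  attach : ∀ P {y a N} → y ∈ˡ verts P → y ∉ˡ hitting P → A a → a ∉ˡ hitting P →
           Walk a y N → Disjoint N (verts P) → Attached P N
  attach (path P) (here refl) y∉ _ _ _ _ = ⊥-elim (y∉ (there (here refl)))
  attach (path P) {y} {a′} {N} (there y∈) y∉ Aa′ a′∉ w N⟂ with splitSimple walk simple y∈
    where open APath P
  ... | p , q , wp , wq , y∉p , y∉q , p⟂q , p⊆ , q⊆ =
    tripod T ∷ [] , refl , [] ∷ [] , λ { (here refl) → within }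
    where
    open APath P
    T : Tripod
    T = record
      { A₁ = Aa ; A₂ = Ab ; A₃ = Aa′ ; a₁≢a₂ = a≢b
      ; a₁≢a₃ = λ { refl → a′∉ (here refl) } ; a₂≢a₃ = λ { refl → a′∉ (there (here refl)) }
      ; w₁ = wp ; w₂ = wq ; w₃ = w ; u∉l₁ = y∉p ; u∉l₂ = y∉q
      ; u∉l₃ = λ y∈N → N⟂ (y∈N , there y∈) ; l₁⟂l₂ = p⟂q
      ; l₁⟂l₃ = λ { (x∈p , x∈N) → N⟂ (x∈N , there (p⊆ x∈p)) }
      ; l₂⟂l₃ = λ { (x∈q , x∈N) → N⟂ (x∈N , q⊆ x∈q) } }
    within : ∀ {x} → x ∈ˡ y ∷ p ++ q ++ N → x ∈ˡ b ∷ l ⊎ x ∈ˡ N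
    within (here refl) = inj₁ (there y∈)
    within (there x∈) with ∈-++⁻ p x∈
    ... | inj₁ x∈p = inj₁ (there (p⊆ x∈p))
    ... | inj₂ x∈′ with ∈-++⁻ q x∈′
    ...   | inj₁ x∈q = inj₁ (q⊆ x∈q)
    ...   | inj₂ x∈N = inj₂ x∈N
  attach (tripod T) (here refl) y∉ _ _ _ _ = ⊥-elim (y∉ (here refl))
  attach (tripod T) {y} {a} {N} (there y∈) y∉ Aa a∉ w N⟂ = byArm (∈-++⁻ l₁ y∈)
    where
    open Tripod T
    in₁ : ∀ {x} → x ∈ˡ l₁ → x ∈ˡ verts (tripod T)
    in₁ x∈ = there (∈-++⁺ˡ x∈)
    in₂ : ∀ {x} → x ∈ˡ l₂ → x ∈ˡ verts (tripod T)
    in₂ x∈ = there (∈-++⁺ʳ l₁ (∈-++⁺ˡ x∈))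
    in₃ : ∀ {x} → x ∈ˡ l₃ → x ∈ˡ verts (tripod T)
    in₃ x∈ = there (∈-++⁺ʳ l₁ (∈-++⁺ʳ l₂ x∈))
    u∉N : u ∉ˡ N
    u∉N u∈ = N⟂ (u∈ , here refl)
    avoid : ∀ {l} → (∀ {x} → x ∈ˡ l → x ∈ˡ verts (tripod T)) → Disjoint N l
    avoid l⊆ (x∈N , x∈l) = N⟂ (x∈N , l⊆ x∈l)
    module _ {l l′ l″ : List (Fin n)}
             (l⊆ : ∀ {x} → x ∈ˡ l → x ∈ˡ verts (tripod T))
             (l′⊆ : ∀ {x} → x ∈ˡ l′ → x ∈ˡ verts (tripod T))
             (l″⊆ : ∀ {x} → x ∈ˡ l″ → x ∈ˡ verts (tripod T)) where
      conclude : (Σ APath λ P → Σ APath λ Q → Disjoint (APath.vertices P) (APath.vertices Q) ×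
        (∀ {x} → x ∈ˡ APath.vertices P → x ∈ˡ l ⊎ x ∈ˡ N) ×
        (∀ {x} → x ∈ˡ APath.vertices Q → x ∈ˡ u ∷ l′ ++ l″)) → Attached (tripod T) N
      conclude (P , Q , P⟂Q , P⊆ , Q⊆) =
        path P ∷ path Q ∷ [] , refl , (P⟂Q ∷ []) ∷ [] ∷ [] ,
        λ { (here refl) x∈         → [ inj₁ ∘ l⊆ , inj₂ ]′ (P⊆ x∈)
          ; (there (here refl)) x∈ → inj₁ (Q⊆′ (Q⊆ x∈)) }
        where
        Q⊆′ : ∀ {x} → x ∈ˡ u ∷ l′ ++ l″ → x ∈ˡ verts (tripod T)
        Q⊆′ (here refl) = here refl
        Q⊆′ (there x∈)  = [ l′⊆ , l″⊆ ]′ (∈-++⁻ l′ x∈)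
    byArm : y ∈ˡ l₁ ⊎ y ∈ˡ l₂ ++ l₃ → Attached (tripod T) N
    byArm (inj₁ y∈₁) = conclude in₁ in₂ in₃
      (cutArm A₁ A₂ A₃ a₂≢a₃ w₁ w₂ w₃ u∉l₁ l₁⟂l₂ l₁⟂l₃ y∈₁ Aa
        (λ { refl → a∉ (there (here refl)) }) w u∉N (avoid in₂) (avoid in₃))
    byArm (inj₂ y∈′) with ∈-++⁻ l₂ y∈′
    ... | inj₁ y∈₂ = conclude in₂ in₁ in₃
      (cutArm A₂ A₁ A₃ a₁≢a₃ w₂ w₁ w₃ u∉l₂ (Disjoint-sym l₁⟂l₂) l₂⟂l₃ y∈₂ Aa
        (λ { refl → a∉ (there (there (here refl))) }) w u∉N (avoid in₁) (avoid in₃))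
    ... | inj₂ y∈₃ = conclude in₃ in₁ in₂
      (cutArm A₃ A₁ A₂ a₁≢a₂ w₃ w₁ w₂ u∉l₃ (Disjoint-sym l₁⟂l₃) (Disjoint-sym l₂⟂l₃) y∈₃ Aa
        (λ { refl → a∉ (there (there (there (here refl)))) }) w u∉N (avoid in₁) (avoid in₂))

  -- Growing a family of disjoint pieces

  Frame : List Piece → Set
  Frame = AllPairs _⟂_

  support hittingSet : List Piece → List (Fin n)
  support    = concatMap verts
  hittingSet = concatMap hitting

  leafCount-++ : ∀ Ps Qs → leafCount (Ps ++ Qs) ≡ leafCount Ps + leafCount Qs
  leafCount-++ []       Qs = refl
  leafCount-++ (P ∷ Ps) Qs =
    trans (cong (leaves P +_) (leafCount-++ Ps Qs)) (sym (ℕ.+-assoc (leaves P) _ _))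

  ∈-support : ∀ {P Ps x} → P ∈ˡ Ps → x ∈ˡ verts P → x ∈ˡ support Ps
  ∈-support (here refl) x∈ = ∈-++⁺ˡ x∈
  ∈-support {Ps = Q ∷ _} (there P∈) x∈ = ∈-++⁺ʳ (verts Q) (∈-support P∈ x∈)

  attachFrame : ∀ Ps → Frame Ps → ∀ {y a N} → y ∈ˡ support Ps → y ∉ˡ hittingSet Ps →
    A a → a ∉ˡ hittingSet Ps → Walk a y N → Disjoint N (support Ps) →
    ∃[ Qs ] (leafCount Qs ≡ suc (leafCount Ps) × Frame Qs ×
      (∀ {Q x} → Q ∈ˡ Qs → x ∈ˡ verts Q → x ∈ˡ support Ps ⊎ x ∈ˡ N))
  attachFrame (P ∷ Ps) (P⟂ ∷ F) {y} {a} {N} y∈ y∉ Aa a∉ w N⟂ with ∈-++⁻ (verts P) y∈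
  ... | inj₁ y∈P with attach P y∈P (y∉ ∘ ∈-++⁺ˡ) Aa (a∉ ∘ ∈-++⁺ˡ) w
                     (λ { (x∈N , x∈P) → N⟂ (x∈N , ∈-++⁺ˡ x∈P) })
  ...   | Qs , count , FQ , Qs⊆ =
    Qs ++ Ps , trans (leafCount-++ Qs Ps) (cong (_+ leafCount Ps) count) ,
    AllPairs.++⁺ FQ F (All.tabulate λ Q∈ → All.tabulate λ R∈ → λ { (x∈Q , x∈R) →
      [ (λ x∈P → All.lookup P⟂ R∈ (x∈P , x∈R))
      , (λ x∈N → N⟂ (x∈N , ∈-++⁺ʳ (verts P) (∈-support R∈ x∈R))) ]′ (Qs⊆ Q∈ x∈Q) }) ,
    λ {Q} {x} → within {Q} {x}
    where
    within : ∀ {Q x} → Q ∈ˡ Qs ++ Ps → x ∈ˡ verts Q → x ∈ˡ support (P ∷ Ps) ⊎ x ∈ˡ N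
    within Q∈ x∈ with ∈-++⁻ Qs Q∈
    ... | inj₁ Q∈Qs = [ inj₁ ∘ ∈-++⁺ˡ , inj₂ ]′ (Qs⊆ Q∈Qs x∈)
    ... | inj₂ Q∈Ps = inj₁ (∈-++⁺ʳ (verts P) (∈-support Q∈Ps x∈))
  attachFrame (P ∷ Ps) (P⟂ ∷ F) {y} {a} {N} y∈ y∉ Aa a∉ w N⟂
    | inj₂ y∈Ps with attachFrame Ps F y∈Ps (y∉ ∘ ∈-++⁺ʳ (hitting P)) Aa (a∉ ∘ ∈-++⁺ʳ (hitting P)) w
                     (λ { (x∈N , x∈Ps) → N⟂ (x∈N , ∈-++⁺ʳ (verts P) x∈Ps) })
  ...   | Qs , count , FQ , Qs⊆ =
    P ∷ Qs , trans (cong (leaves P +_) count) (ℕ.+-suc (leaves P) _) ,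
    All.tabulate (λ Q∈ → λ { (x∈P , x∈Q) →
      [ apart x∈P , (λ x∈N → N⟂ (x∈N , ∈-++⁺ˡ x∈P)) ]′ (Qs⊆ Q∈ x∈Q) }) ∷ FQ ,
    λ { (here refl) x∈ → inj₁ (∈-++⁺ˡ x∈)
      ; (there Q∈) x∈  → [ inj₁ ∘ ∈-++⁺ʳ (verts P) , inj₂ ]′ (Qs⊆ Q∈ x∈) }
    where
    apart′ : ∀ {Rs x} → All (P ⟂_) Rs → x ∈ˡ verts P → x ∈ˡ support Rs → ⊥
    apart′ {R ∷ Rs} (P⟂R ∷ P⟂Rs) x∈P x∈ with ∈-++⁻ (verts R) x∈
    ... | inj₁ x∈R  = P⟂R (x∈P , x∈R)
    ... | inj₂ x∈Rs = apart′ P⟂Rs x∈P x∈Rs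
    apart : ∀ {x} → x ∈ˡ verts P → x ∈ˡ support Ps → ⊥
    apart = apart′ P⟂

  blocking : List Piece → Subset n
  blocking Ps = fromList (hittingSet Ps)

  -- The walk is followed to its first vertex in the support. Its initial segment is an arm to
  -- attach there; if no such vertex exists, the loop-erased walk is itself a new piece with two
  -- leaves.
  enlarge : ∀ Ps → Frame Ps → ∀ {a b} → A a → A b → a ≢ b → Reach G (blocking Ps) a b →
            ∃[ Qs ] (leafCount Ps < leafCount Qs × Frame Qs)
  enlarge Ps F Aa Ab a≢b r with reach⇒walk r
  ... | l , w , l∉ with firstHit (_∈ˡ? support Ps) w
  ...   | inj₂ (y , N , y∈ , y∈l , w′ , N⟂)
    with attachFrame Ps F y∈ (l∉ y∈l ∘ ∈-fromList) Aa (l∉ (source∈ w) ∘ ∈-fromList) w′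
                     (λ { (x∈N , x∈Ps) → N⟂ x∈N x∈Ps })
  ...     | Qs , count , FQ , _ = Qs , ℕ.≤-reflexive (sym count) , FQ
  enlarge Ps F Aa Ab a≢b r | l , w , l∉ | inj₁ l⟂ with erase w
  ...   | m , w′ , s , m⊆ =
    path (record { Aa = Aa ; Ab = Ab ; a≢b = a≢b ; walk = w′ ; simple = s }) ∷ Ps ,
    ℕ.n≤1+n _ ,
    All.tabulate (λ Q∈ → λ { (x∈m , x∈Q) → l⟂ (m⊆ x∈m) (∈-support Q∈ x∈Q) }) ∷ F

  leafCount≤ : ∀ Ps → leafCount Ps ≤ length Ps * 3
  leafCount≤ []              = z≤n
  leafCount≤ (path _ ∷ Ps)   = s≤s (s≤s (ℕ.m≤n⇒m≤1+n (leafCount≤ Ps)))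
  leafCount≤ (tripod _ ∷ Ps) = s≤s (s≤s (s≤s (leafCount≤ Ps)))

  length-hittingSet : ∀ Ps → length (hittingSet Ps) ≤ length Ps * 4
  length-hittingSet []              = z≤n
  length-hittingSet (path _ ∷ Ps)   =
    s≤s (s≤s (ℕ.m≤n⇒m≤1+n (ℕ.m≤n⇒m≤1+n (length-hittingSet Ps))))
  length-hittingSet (tripod _ ∷ Ps) = s≤s (s≤s (s≤s (s≤s (length-hittingSet Ps))))

  Hits : Subset n → Set
  Hits Z = ∀ {a b} → A a → A b → Reach G Z a b → a ≡ b

  -- Each round adds a leaf, and fewer than `c` pieces have fewer than `c * 3` leaves, so `c * 3`
  -- rounds suffice. The fuel `f` counts the rounds left; at `zero` the invariant
  -- `c * 3 ≤ f + leafCount Ps` forces `c` pieces.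
  packing-or-hitting : ∀ c → (∃[ Ps ] (c ≤ length Ps × Frame Ps)) ⊎
                             (∃[ Z ] (∣ Z ∣ ≤ c * 4 × Hits Z))
  packing-or-hitting c = search (c * 3) [] [] (ℕ.m≤m+n (c * 3) 0)
    where
    search : ∀ f Ps → Frame Ps → c * 3 ≤ f + leafCount Ps →
             (∃[ Qs ] (c ≤ length Qs × Frame Qs)) ⊎ (∃[ Z ] (∣ Z ∣ ≤ c * 4 × Hits Z))
    search f Ps F big with c ≤? length Ps
    ... | yes c≤ = inj₁ (Ps , c≤ , F)
    ... | no  c≰ with any? (λ a → any? (λ b →
                  A? a ×-dec A? b ×-dec ¬? (a ≟ b) ×-dec reach? G? (blocking Ps) a b))
    ...   | no none = inj₂ (blocking Ps , size , hits)
      where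
      size : ∣ blocking Ps ∣ ≤ c * 4
      size = ℕ.≤-trans (∣fromList∣≤length (hittingSet Ps))
               (ℕ.≤-trans (length-hittingSet Ps) (ℕ.*-monoˡ-≤ 4 (ℕ.<⇒≤ (ℕ.≰⇒> c≰))))
      hits : Hits (blocking Ps)
      hits {a} {b} Aa Ab r with a ≟ b
      ... | yes a≡b = a≡b
      ... | no  a≢b = ⊥-elim (none (a , b , Aa , Ab , a≢b , r))
    search zero Ps F big | no c≰ | yes _ =
      ⊥-elim (c≰ (ℕ.*-cancelʳ-≤ c (length Ps) 3 (ℕ.≤-trans big (leafCount≤ Ps))))
    search (suc f) Ps F big | no _ | yes (a , b , Aa , Ab , a≢b , r) with enlarge Ps F Aa Ab a≢b r
    ... | Qs , more , FQ = search f Qs FQ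
      (ℕ.≤-trans big (ℕ.≤-trans (ℕ.≤-reflexive (sym (ℕ.+-suc f _))) (ℕ.+-monoʳ-≤ f more)))

  -- From walks to indexed paths

  at : ∀ {a b l} → Walk a b l → Fin (suc (length l)) → Fin n
  at {a} w       zero    = a
  at     (_ ∷ w) (suc i) = at w i

  at∈ : ∀ {a b l} (w : Walk a b l) i → at w i ∈ˡ b ∷ l
  at∈ w       zero    = source∈ w
  at∈ (_ ∷ w) (suc i) = ∷-skip (at∈ w i)

  at-last : ∀ {a b l} (w : Walk a b l) → at w (fromℕ (length l)) ≡ b
  at-last []      = refl
  at-last (_ ∷ w) = at-last w

  at-adj : ∀ {a b l} (w : Walk a b l) (j : Fin (length l)) → G (at w (inject₁ j)) (at w (suc j))
  at-adj (e ∷ w) zero    = e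
  at-adj (_ ∷ w) (suc j) = at-adj w j

  at-inj : ∀ {a b l} (w : Walk a b l) → Simple b l → ∀ i j → at w i ≡ at w j → i ≡ j
  at-inj w       _        zero    zero    _  = refl
  at-inj (_ ∷ w) (a∉ , _) zero    (suc j) eq = ⊥-elim (a∉ (subst (_∈ˡ _) (sym eq) (at∈ w j)))
  at-inj (_ ∷ w) (a∉ , _) (suc i) zero    eq = ⊥-elim (a∉ (subst (_∈ˡ _) eq (at∈ w i)))
  at-inj (_ ∷ w) (_ , s)  (suc i) (suc j) eq = cong suc (at-inj w s i j eq)

  toPathIn : (P : APath) → Σ (PathIn G) λ Q →
             A (PathIn.start Q) × A (PathIn.end Q) × (∀ i → PathIn.p Q i ∈ˡ APath.vertices P)
  -- A `PathIn` has at least one edge; distinct ends exclude the empty walk.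
  toPathIn record { a≢b = a≢b ; walk = [] } = ⊥-elim (a≢b refl)
  toPathIn record { Aa = Aa ; Ab = Ab ; walk = w@(_ ∷ _) ; simple = s } =
    record { ℓ = _ ; p = at w ; inj = at-inj w s ; adj = at-adj w } ,
    Aa , subst A (sym (at-last w)) Ab , at∈ w

  frame-disjoint : ∀ {Ps} → Frame Ps → ∀ i j → i ≢ j → List.lookup Ps i ⟂ List.lookup Ps j
  frame-disjoint (_ ∷ _)  zero    zero    i≢j = ⊥-elim (i≢j refl)
  frame-disjoint (P⟂ ∷ _) zero    (suc j) _   = All.lookup P⟂ (∈-lookup j)
  frame-disjoint (P⟂ ∷ _) (suc i) zero    _   = Disjoint-sym (All.lookup P⟂ (∈-lookup i))
  frame-disjoint (_ ∷ F)  (suc i) (suc j) i≢j = frame-disjoint F i j (i≢j ∘ cong suc)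

-- Flowers versus separators of a color class

module _ (H : ColoredGraph) where

  open ColoredGraph H

  adj-sym : ∀ {u v} → Adj u v → Adj v u
  adj-sym {u} {v} e = trans (E-sym v u) e

  bullet-sym : ∀ {u v} → AdjBullet u v → AdjBullet v u
  bullet-sym (inj₁ e)          = inj₁ (adj-sym e)
  bullet-sym (inj₂ (eq , u≢v)) = inj₂ (sym eq , u≢v ∘ sym)

  bullet? : ∀ u v → Dec (AdjBullet u v)
  bullet? u v = E u v Bool.≟ true ⊎-dec (col u ≟ col v ×-dec ¬? (u ≟ v))

  except-sym : ∀ i {u v} → AdjBulletExcept i u v → AdjBulletExcept i v u
  except-sym i (inj₁ e)                = inj₁ (adj-sym e)
  except-sym i (inj₂ (eq , ≢i , u≢v)) = inj₂ (sym eq , ≢i ∘ trans eq , u≢v ∘ sym)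

  except? : ∀ i u v → Dec (AdjBulletExcept i u v)
  except? i u v = E u v Bool.≟ true ⊎-dec (col u ≟ col v ×-dec ¬? (col u ≟ i) ×-dec ¬? (u ≟ v))

  hat-sym : ∀ {i j} → AdjHat i j → AdjHat j i
  hat-sym (i≢j , u , v , cu , cv , e) = i≢j ∘ sym , v , u , cv , cu , adj-sym e

  SeparatesClass : Fin k → Subset n → Set
  SeparatesClass i Z = ∀ {a b} → col a ≡ i → col b ≡ i → Reach (AdjBulletExcept i) Z a b → a ≡ b

  -- The packing alternative for `H^{•∖i}` with the vertices of color `i` as terminals. Every piece,
  -- a claw too, contains a path between terminals, so the first `c` pieces of a frame carry a
  -- flower.
  flower-or-separator : ∀ c i → Flower H c i ⊎ (∃[ Z ] (∣ Z ∣ ≤ c * 4 × SeparatesClass i Z))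
  flower-or-separator c i with packing-or-hitting c
    where open Packing (AdjBulletExcept i) (except-sym i) (except? i) (λ v → col v ≡ i) (λ v → col v ≟ i)
  ... | inj₂ Z = inj₂ Z
  ... | inj₁ (Ps , c≤ , F) = inj₁ record
    { path      = proj₁ ∘ petal
    ; start-col = proj₁ ∘ proj₂ ∘ petal
    ; end-col   = proj₁ ∘ proj₂ ∘ proj₂ ∘ petal
    ; disjoint  = λ r s r≢s x y eq →
        frame-disjoint F (index r) (index s) (r≢s ∘ Fin.inject≤-injective c≤ c≤ r s)
          (inPiece r x , subst (_∈ˡ verts (piece s)) (sym eq) (inPiece s y)) }
    where
    open Packing (AdjBulletExcept i) (except-sym i) (except? i) (λ v → col v ≡ i) (λ v → col v ≟ i)
    index : Fin c → Fin (length Ps)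
    index r = inject≤ r c≤
    piece : Fin c → Piece
    piece = List.lookup Ps ∘ index
    petal : ∀ r → _
    petal r = toPathIn (proj₁ (pieceToPath (piece r)))
    inPiece : ∀ r x → PathIn.p (proj₁ (petal r)) x ∈ˡ verts (piece r)
    inPiece r x = proj₂ (pieceToPath (piece r)) (proj₂ (proj₂ (proj₂ (petal r))) x)

largest : ∀ {m} {P : Fin m → Set} → (∀ i → Dec (P i)) →
          (∃[ t ] (P t × (∀ s → toℕ t < toℕ s → ¬ P s))) ⊎ (∀ s → ¬ P s)
largest {zero}  P? = inj₂ λ ()
largest {suc m} P? with largest (P? ∘ suc)
... | inj₁ (t , pt , above) =
  inj₁ (suc t , pt , λ { (suc s) (s≤s t<s) → above s t<s })
... | inj₂ none with P? zero
...   | yes p0 = inj₁ (zero , p0 , λ { (suc s) _ → none s })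
...   | no ¬p0 = inj₂ λ { zero → ¬p0 ; (suc s) → none s }

-- Balanced separation of a set of vertices by a bag

module Balance {n k : ℕ} {Ĝ : Fin k → Fin k → Set} (Ĝ-sym : ∀ {i j} → Ĝ i j → Ĝ j i)
               (TD : TreeDecomposition Ĝ) (col : Fin n → Fin k) (X : Subset n) where

  open TreeDecomposition TD

  data Below (r : Node) : Node → Set where
    here : Below r r
    down : ∀ {i} → Below r (parent i) → Below r (suc i)

  below? : ∀ r a → Dec (Below r a)
  below? r a = search a (toℕ a) ℕ.≤-refl
    where
    search : ∀ a b → toℕ a ≤ b → Dec (Below r a)
    search a b a≤b with r ≟ a
    ... | yes refl = yes here
    search zero b _ | no r≢a = no λ { here → r≢a refl }
    search (suc i) (suc b) (s≤s i≤b) | no r≢a =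
      map′ down (λ { here → ⊥-elim (r≢a refl) ; (down p) → p })
           (search (parent i) b (ℕ.≤-trans (parent< i) i≤b))

  below-root : ∀ a → Below zero a
  below-root a = search a (toℕ a) ℕ.≤-refl
    where
    search : ∀ a b → toℕ a ≤ b → Below zero a
    search zero    b       _         = here
    search (suc i) (suc b) (s≤s i≤b) = down (search (parent i) b (ℕ.≤-trans (parent< i) i≤b))

  Touches : Node → Fin k → Set
  Touches r j = ∃[ a ] (Below r a × j ∈ β a)

  touches? : ∀ r j → Dec (Touches r j)
  touches? r j = any? λ a → below? r a ×-dec j ∈? β a

  -- The color `j` does not occur on both sides of the tree edge above `r`; vacuous at the root.
  -- Since the bags of `j` are connected, they then cannot leave the subtree of `r`.
  NoExit : Node → Fin k → Set
  NoExit r j = ∀ {i} → suc i ≡ r → ¬ (j ∈ β (suc i) × j ∈ β (parent i))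

  stays-below : ∀ {r j a b} → NoExit r j → Below r a → WalkIn (λ t → j ∈ β t) a b → Below r b
  stays-below ne p (here _) = p
  stays-below {r} {j} ne p (step {a} {b} ja a~b w) = stays-below ne (move a p ja a~b) w
    where
    source : ∀ {a b} → WalkIn (λ t → j ∈ β t) a b → j ∈ β a
    source (here s)     = s
    source (step s _ _) = s
    move : ∀ a → Below r a → j ∈ β a → TAdj a b → Below r b
    move (suc i) here     ja (inj₁ refl) = ⊥-elim (ne refl (ja , source w))
    move (suc i) (down p) ja (inj₁ refl) = p
    move a       p        ja (inj₂ b↑)   = up b b↑
      where
      up : ∀ b → IsParentOf b a → Below r b
      up (suc i) refl = down p

  -- The bag covering the edge contains `j`, and a walk through bags of `j` reaches it without
  -- leaving the subtree of `r`.
  touches-closed : ∀ {r j j′} → NoExit r j → Touches r j → Ĝ j j′ → Touches r j′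
  touches-closed {j = j} {j′} ne (a , p , ja) e with cover-e j j′ e
  ... | d , jd , j′d = d , stays-below ne p (connected j a d ja jd) , j′d

  child-below : ∀ {t a} → Below t a → a ≡ t ⊎ ∃[ i ] (parent i ≡ t × Below (suc i) a)
  child-below here = inj₁ refl
  child-below (down {i} p) with child-below p
  ... | inj₁ eq            = inj₂ (i , eq , here)
  ... | inj₂ (s , eq , p′) = inj₂ (s , eq , down p′)

  lower : Node → Subset n
  lower r = select (touches? r ∘ col)

  -- A certificate that replaces the component of `j` in the graph minus `β t`: `Side` is closed
  -- under edges outside the bag, hence contains that component, and `Q` holds all vertices of `X`
  -- with a color in `Side`.
  record LightSide (t : Node) (j : Fin k) : Set₁ where
    field
      Side   : Fin k → Set
      inSide : Side j
      closed : ∀ {i i′} → Side i → i ∉ β t → i′ ∉ β t → Ĝ i i′ → Side i′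
      Q      : Subset n
      light  : ∣ Q ∣ + ∣ Q ∣ ≤ ∣ X ∣
      inQ    : ∀ {x} → x ∈ X → Side (col x) → x ∈ Q

  opaque

    -- The last node (in the numbering) whose subtree touches half of X.
    balanced-node : ∃[ t ] (∀ j → j ∉ β t → LightSide t j)
    balanced-node with largest (λ r → ∣ X ∣ ≤? ∣ X ∩ lower r ∣ + ∣ X ∩ lower r ∣)
    -- The root always qualifies, because every bag lies below it.
    ... | inj₂ none = ⊥-elim (none zero
      (ℕ.≤-trans (∣∣-mono X (X ∩ lower zero) λ {x} x∈ → x∈p∩q⁺ (x∈ ,
          ∈-select⁺ (touches? zero ∘ col) (proj₁ (cover-v (col x)) , below-root _ , proj₂ (cover-v (col x)))))
        (ℕ.m≤m+n _ _)))
    ... | inj₁ (t , heavy , above) = t , side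
      where
      side : ∀ j → j ∉ β t → LightSide t j
      side j j∉ with touches? t j
      -- The side above `t`: the subtree of `t` touches at least half of `X`, so at most half
      -- remains.
      ... | no ¬T = record
        { Side = λ i → ¬ Touches t i
        ; inSide = ¬T
        ; closed = λ ¬Ti _ i′∉ e Ti′ → ¬Ti (touches-closed (λ { refl (i∈ , _) → i′∉ i∈ }) Ti′ (Ĝ-sym e))
        ; Q = X ─ lower t
        ; light = lemma ∣ X ∩ lower t ∣ ∣ X ─ lower t ∣ (∣p∣≡∣p∩q∣+∣p─q∣ X (lower t)) heavy
        ; inQ = λ x∈ ¬Tx → x∈p∧x∉q⇒x∈p─q x∈ (¬Tx ∘ ∈-select⁻ (touches? t ∘ col)) }
        where
        lemma : ∀ {x} a q → x ≡ a + q → x ≤ a + a → q + q ≤ x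
        lemma a q refl x≤ = ℕ.+-monoˡ-≤ q (ℕ.+-cancelˡ-≤ a q a x≤)
      ... | yes (a , p , ja) with child-below p
      ...   | inj₁ refl = ⊥-elim (j∉ ja)
      -- The side below a child: its number exceeds that of `t`, so by the choice of `t` its subtree
      -- touches less than half of `X`.
      ...   | inj₂ (i , refl , p′) = record
        { Side = Touches (suc i)
        ; inSide = a , p′ , ja
        ; closed = λ Ti i∉ _ e → touches-closed (λ { refl (_ , i∈) → i∉ i∈ }) Ti e
        ; Q = X ∩ lower (suc i)
        ; light = ℕ.<⇒≤ (ℕ.≰⇒> (above (suc i) (s≤s (parent< i))))
        ; inQ = λ x∈ Tx → x∈p∩q⁺ (x∈ , ∈-select⁺ (touches? (suc i) ∘ col) Tx) }

-- One bag of the decomposition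

module Step (H : ColoredGraph) {w c : ℕ}
            (TDH : TreeDecomposition (ColoredGraph.AdjHat H))
            (narrow : ∀ t → ∣ TreeDecomposition.β TDH t ∣ ≤ suc w)
            (separator : ∀ i → ∃[ Z ] (∣ Z ∣ ≤ c * 4 × SeparatesClass H i Z)) where

  open ColoredGraph H
  open TreeDecomposition TDH using () renaming (β to β̂)

  S : Fin k → Subset n
  S i = proj₁ (separator i)

  private
    linked? : ∀ i j u → Dec (col u ≡ i × ∃[ v ] (col v ≡ j × Reach (AdjBulletExcept i) (S i) u v))
    linked? i j u =
      col u ≟ i ×-dec any? λ v → col v ≟ j ×-dec reach? (except? H i) (S i) u v

  linked : Fin k → Fin k → Subset n
  linked i j = select (linked? i j)

  -- The class j is a clique outside class i, so all its vertices lie in one component of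
  -- H^{•∖i} − S i, which contains at most one vertex of class i.
  ∣linked∣≤1 : ∀ {i j} → i ≢ j → ∣ linked i j ∣ ≤ 1
  ∣linked∣≤1 {i} {j} i≢j = subsingleton⇒∣p∣≤1 (linked i j) unique
    where
    across : ∀ {v v′} → col v ≡ j → col v′ ≡ j → v ∉ S i → v′ ∉ S i →
             Reach (AdjBulletExcept i) (S i) v v′
    across {v} {v′} cv cv′ v∉ v′∉ with v ≟ v′
    ... | yes refl = stop v∉
    ... | no  v≢v′ = reach-edge v∉ v′∉
      (inj₂ (trans cv (sym cv′) , (λ cv≡i → i≢j (trans (sym cv≡i) cv)) , v≢v′))
    unique : ∀ {u u′} → u ∈ linked i j → u′ ∈ linked i j → u ≡ u′
    unique u∈ u′∈ with ∈-select⁻ (linked? i j) u∈ | ∈-select⁻ (linked? i j) u′∈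
    ... | cu , v , cv , r | cu′ , v′ , cv′ , r′ =
      proj₂ (proj₂ (separator i)) cu cu′
        (reach-trans r (reach-trans (across cv cv′ (reach-target r) (reach-target r′))
                                    (reach-sym (except-sym H i) r′)))

  -- A bag has at most `suc w` colors `i`; each contributes its separator, of size at most `c * 4`,
  -- and at most one linked vertex for every other color of the bag. The second `suc w` still counts
  -- `i` itself.
  coreBound : ℕ
  coreBound = suc w * (c * 4 + suc w)

  core : Subset k → Subset n
  core B = ⋃⟨ B ⟩ λ i → S i ∪ ⋃⟨ B - i ⟩ (linked i)

  S⊆core : ∀ {B i v} → i ∈ B → v ∈ S i → v ∈ core B
  S⊆core i∈ v∈ = ∈-⋃⁺ i∈ (x∈p∪q⁺ (inj₁ v∈))

  ∣core∣≤ : ∀ t → ∣ core (β̂ t) ∣ ≤ coreBound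
  ∣core∣≤ t = ℕ.≤-trans (∣⋃∣≤ B (λ i → S i ∪ ⋃⟨ B - i ⟩ (linked i)) (λ {i} _ → each i))
                        (ℕ.*-monoˡ-≤ (c * 4 + suc w) (narrow t))
    where
    B = β̂ t
    each : ∀ i → ∣ S i ∪ ⋃⟨ B - i ⟩ (linked i) ∣ ≤ c * 4 + suc w
    each i = ℕ.≤-trans (∣p∪q∣≤∣p∣+∣q∣ (S i) _) (ℕ.+-mono-≤ (proj₁ (proj₂ (separator i)))
      (ℕ.≤-trans (∣⋃∣≤ (B - i) (linked i) (λ j∈ → ∣linked∣≤1 λ { refl → x∈p─q⇒x∉q B ⁅ i ⁆ j∈ (x∈⁅x⁆ i) }))
        (ℕ.≤-trans (ℕ.≤-reflexive (ℕ.*-identityʳ _))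
          (ℕ.≤-trans (∣∣-mono (B - i) B (p─q⊆p B ⁅ i ⁆)) (narrow t)))))

  -- If the colors agree, the separator forces equality; if they differ, `z` is a linked vertex and
  -- so belongs to the core. Both the vertex cover property and the uniqueness of the unguarded
  -- neighbor rest on this.
  linked⇒≡ : ∀ {B z z′} → col z ∈ B → col z′ ∈ B → z ∉ core B →
             Reach (AdjBulletExcept (col z)) (S (col z)) z z′ → z ≡ z′
  linked⇒≡ {B} {z} {z′} z∈B z′∈B z∉ r with col z′ ≟ col z
  ... | yes eq = proj₂ (proj₂ (separator (col z))) refl eq r
  ... | no neq = ⊥-elim (z∉ (∈-⋃⁺ z∈B (x∈p∪q⁺ {p = S (col z)} (inj₂
    (∈-⋃⁺ (x∈p∧x≢y⇒x∈p-y z′∈B neq) (∈-select⁺ (linked? (col z) (col z′)) (refl , z′ , refl , r)))))))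

  Comp : Subset n → Fin n → Fin n → Set
  Comp = Reach AdjBullet

  comp? : ∀ U x y → Dec (Comp U x y)
  comp? = reach? (bullet? H)

  private
    boundary? : ∀ U x z → Dec (z ∈ U × ∃[ y ] (Comp U x y × AdjBullet y z))
    boundary? U x z = z ∈? U ×-dec any? λ y → comp? U x y ×-dec bullet? H y z

  opaque

    -- The neighborhood N(D) in `U` of the component D of `x` in `H^•` minus `U`.
    boundary : Subset n → Fin n → Subset n
    boundary U x = select (boundary? U x)

    boundary⁺ : ∀ {U x y z} → z ∈ U → Comp U x y → AdjBullet y z → z ∈ boundary U x
    boundary⁺ z∈ r e = ∈-select⁺ (boundary? _ _) (z∈ , _ , r , e)

    boundary⁻ : ∀ {U x z} → z ∈ boundary U x → z ∈ U × ∃[ y ] (Comp U x y × AdjBullet y z)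
    boundary⁻ = ∈-select⁻ (boundary? _ _)

  -- The fixed point of q ↦ q/2 + 1 + ∣ core B ∪ ⁅ x ⁆ ∣: half of the old boundary, the one
  -- unguarded vertex and the new guard.
  adhesionBound guardBound colorBound : ℕ
  adhesionBound = (2 + coreBound) + (2 + coreBound)
  guardBound    = adhesionBound + suc coreBound
  colorBound    = guardBound + suc w

  colors : Subset n → Subset k
  colors P = select λ j → any? λ u → u ∈? P ×-dec col u ≟ j

  record IsGuardedBag (β g : Subset n) : Set where
    field
      g⊆β     : ∀ {v} → v ∈ g → v ∈ β
      cover   : ∀ {u v} → Adj u v → u ∈ β → v ∈ β → u ∈ g ⊎ v ∈ g
      ∣g∣≤    : ∣ g ∣ ≤ guardBound
      colors≤ : ∣ colors β ∣ ≤ colorBound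

  -- What a bag and its guard must satisfy for a child with adhesion set within `P` to be hung below
  -- them.
  record Attachable (β g P : Subset n) : Set where
    field
      P⊆β    : ∀ {v} → v ∈ P → v ∈ β
      ∣P─g∣≤ : ∣ P ─ g ∣ ≤ 1
      ∣P∣≤   : ∣ P ∣ ≤ adhesionBound

  -- The new bag and its guard

  module _ (U : Subset n) {x : Fin n} (x∉U : x ∉ U)
           (∣∂∣≤ : ∣ boundary U x ∣ ≤ adhesionBound) where

    open Balance (hat-sym H) TDH col (boundary U x) using (LightSide; balanced-node)

    private
      X D B̂ K : Subset n
      B : Subset k
      node = proj₁ balanced-node
      X = boundary U x
      D = select (comp? U x)
      B = β̂ node
      B̂ = select λ v → col v ∈? B
      -- Including `x` ensures that every new bag covers a fresh vertex, even if `x` is in neither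
      -- the classes of `B` nor the core; termination depends on it.
      K = core B ∪ ⁅ x ⁆

      D⁻ : ∀ {v} → v ∈ D → Comp U x v
      D⁻ = ∈-select⁻ (comp? U x)
      D⁺ : ∀ {v} → Comp U x v → v ∈ D
      D⁺ = ∈-select⁺ (comp? U x)
      B̂⁻ : ∀ {v} → v ∈ B̂ → col v ∈ B
      B̂⁻ = ∈-select⁻ (λ v → col v ∈? B)
      B̂⁺ : ∀ {v} → col v ∈ B → v ∈ B̂
      B̂⁺ = ∈-select⁺ (λ v → col v ∈? B)
      core⊆K : ∀ {v} → v ∈ core B → v ∈ K
      core⊆K v∈ = x∈p∪q⁺ (inj₁ v∈)

    newGuard newBag : Subset n
    newGuard = X ∪ (D ∩ K)
    newBag   = newGuard ∪ (D ∩ B̂)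

    private
      U′ : Subset n
      U′ = U ∪ newBag

      U⊆U′ : ∀ {v} → v ∈ U → v ∈ U′
      U⊆U′ v∈ = x∈p∪q⁺ (inj₁ v∈)

      g⊆bag : ∀ {v} → v ∈ newGuard → v ∈ newBag
      g⊆bag v∈ = x∈p∪q⁺ (inj₁ v∈)

      DK⊆g : ∀ {v} → v ∈ D → v ∈ K → v ∈ newGuard
      DK⊆g v∈D v∈K = x∈p∪q⁺ {p = X} (inj₂ (x∈p∩q⁺ (v∈D , v∈K)))

      DB̂⊆bag : ∀ {v} → v ∈ D → v ∈ B̂ → v ∈ newBag
      DB̂⊆bag v∈D v∈B̂ = x∈p∪q⁺ {p = newGuard} (inj₂ (x∈p∩q⁺ (v∈D , v∈B̂)))

    boundary⊆guard : ∀ {v} → v ∈ boundary U x → v ∈ newGuard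
    boundary⊆guard v∈ = x∈p∪q⁺ (inj₁ v∈)

    x∈newBag : x ∈ newBag
    x∈newBag = g⊆bag (DK⊆g (D⁺ (stop x∉U)) (x∈p∪q⁺ {p = core B} (inj₂ (x∈⁅x⁆ x))))

    private
      unguarded : ∀ {v} → v ∈ newBag → v ∉ newGuard → v ∈ D × col v ∈ B × v ∉ core B
      unguarded v∈ v∉ with x∈p∪q⁻ newGuard (D ∩ B̂) v∈
      ... | inj₁ v∈g = ⊥-elim (v∉ v∈g)
      ... | inj₂ v∈DB with x∈p∩q⁻ D B̂ v∈DB
      ...   | v∈D , v∈B = v∈D , B̂⁻ v∈B , λ v∈core → v∉ (DK⊆g v∈D (core⊆K v∈core))

    newBag⊆ : ∀ {v} → v ∈ newBag → v ∈ boundary U x ⊎ Comp U x v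
    newBag⊆ {v} v∈ with v ∈? newGuard
    ... | no  v∉ = inj₂ (D⁻ (proj₁ (unguarded v∈ v∉)))
    ... | yes v∈g with x∈p∪q⁻ X (D ∩ K) v∈g
    ...   | inj₁ v∈X  = inj₁ v∈X
    ...   | inj₂ v∈DK = inj₂ (D⁻ (proj₁ (x∈p∩q⁻ D K v∈DK)))

    private
      ∣K∣≤ : ∣ K ∣ ≤ suc coreBound
      ∣K∣≤ = ℕ.≤-trans (∣p∪q∣≤∣p∣+∣q∣ (core B) ⁅ x ⁆) (ℕ.≤-trans
        (ℕ.+-mono-≤ (∣core∣≤ node) (ℕ.≤-reflexive (∣⁅x⁆∣≡1 x))) (ℕ.≤-reflexive (ℕ.+-comm coreBound 1)))

      ∣newGuard∣≤ : ∣ newGuard ∣ ≤ guardBound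
      ∣newGuard∣≤ = ℕ.≤-trans (∣p∪q∣≤∣p∣+∣q∣ X (D ∩ K))
        (ℕ.+-mono-≤ ∣∂∣≤ (ℕ.≤-trans (∣p∩q∣≤∣q∣ D K) ∣K∣≤))

      ∣colors∣≤ : ∣ colors newBag ∣ ≤ colorBound
      ∣colors∣≤ = ℕ.≤-trans (∣∣-mono (colors newBag) (guardColors ∪ B) split)
        (ℕ.≤-trans (∣p∪q∣≤∣p∣+∣q∣ guardColors B) (ℕ.+-mono-≤
          (ℕ.≤-trans (∣⋃∣≤ newGuard (⁅_⁆ ∘ col) λ {u} _ → ℕ.≤-reflexive (∣⁅x⁆∣≡1 (col u)))
            (ℕ.≤-trans (ℕ.≤-reflexive (ℕ.*-identityʳ _)) ∣newGuard∣≤)) (narrow node)))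
        where
        guardColors = ⋃⟨ newGuard ⟩ (⁅_⁆ ∘ col)
        split : ∀ {j} → j ∈ colors newBag → j ∈ guardColors ∪ B
        split {j} j∈ with ∈-select⁻ (λ j → any? λ u → u ∈? newBag ×-dec col u ≟ j) j∈
        ... | u , u∈ , refl with u ∈? newGuard
        ...   | yes u∈g = x∈p∪q⁺ (inj₁ (∈-⋃⁺ u∈g (x∈⁅x⁆ (col u))))
        ...   | no  u∉g = x∈p∪q⁺ {p = guardColors} (inj₂ (proj₁ (proj₂ (unguarded u∈ u∉g))))

    newBag-guarded : IsGuardedBag newBag newGuard
    newBag-guarded = record
      { g⊆β = g⊆bag ; cover = cover ; ∣g∣≤ = ∣newGuard∣≤ ; colors≤ = ∣colors∣≤ }
      where
      cover : ∀ {u v} → Adj u v → u ∈ newBag → v ∈ newBag → u ∈ newGuard ⊎ v ∈ newGuard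
      cover {u} {v} e u∈ v∈ with u ∈? newGuard | v ∈? newGuard
      ... | yes u∈g | _       = inj₁ u∈g
      ... | no  _   | yes v∈g = inj₂ v∈g
      ... | no  u∉g | no  v∉g with unguarded u∈ u∉g | unguarded v∈ v∉g
      ...   | _ , u∈B , u∉core | _ , v∈B , v∉core
        -- An edge between two unguarded vertices would be a walk avoiding the separator of the
        -- color of `u`, hence a loop.
        with linked⇒≡ u∈B v∈B u∉core (reach-edge (u∉core ∘ S⊆core u∈B) (v∉core ∘ S⊆core u∈B) (inj₁ e))
      ...     | refl = contradiction (trans (sym e) (E-irr u)) λ ()

    -- A component other than D gains no neighbors: a neighbor in the new bag lies in N(D), which is
    -- part of `U`, or in D, and then `y` would lie in D as well.
    old-boundary : ∀ {y z} → ¬ Comp U x y → z ∈ boundary U′ y → z ∈ boundary U y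
    old-boundary ¬r z∈ with boundary⁻ z∈
    ... | z∈U′ , y′ , r , e with x∈p∪q⁻ U newBag z∈U′
    ...   | inj₁ z∈U = boundary⁺ z∈U (reach-antitone U⊆U′ r) e
    ...   | inj₂ z∈bag with newBag⊆ z∈bag
    ...     | inj₁ z∈X = boundary⁺ (proj₁ (boundary⁻ z∈X)) (reach-antitone U⊆U′ r) e
    ...     | inj₂ x⇝z = ⊥-elim (¬r (reach-trans x⇝z (reach-sym (bullet-sym H)
                (reach-trans r′ (reach-edge (reach-target r′) (reach-target x⇝z) e)))))
      where r′ = reach-antitone U⊆U′ r

    -- The components that remain of D

    module _ {y : Fin n} (y∉U′ : y ∉ U′) (x⇝y : Comp U x y) where

      private
        outside-bag : ∀ {v} → v ∈ D → v ∉ U′ → col v ∉ B × v ∉ core B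
        outside-bag v∈D v∉ = (λ v∈B → v∉ (x∈p∪q⁺ {p = U} (inj₂ (DB̂⊆bag v∈D (B̂⁺ v∈B))))) ,
                             (λ v∈core → v∉ (x∈p∪q⁺ {p = U} (inj₂ (g⊆bag (DK⊆g v∈D (core⊆K v∈core))))))

        in-D : ∀ {v} → Comp U′ y v → v ∈ D
        in-D r = D⁺ (reach-trans x⇝y (reach-antitone U⊆U′ r))

        off-bag : ∀ {v} → Comp U′ y v → col v ∉ B × v ∉ core B
        off-bag r = outside-bag (in-D r) (reach-target r)

        except-edge : ∀ {i u v} → i ∈ B → col u ∉ B → AdjBullet u v → AdjBulletExcept i u v
        except-edge i∈ u∉ (inj₁ e)          = inj₁ e
        except-edge i∈ u∉ (inj₂ (eq , u≢v)) = inj₂ (eq , (λ { refl → u∉ i∈ }) , u≢v)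

        -- What remains of D has no color of `B`, so its walks use no clique edge of class `i`; and
        -- it avoids the core, which contains `S i`.
        except-reach : ∀ {i u v} → i ∈ B → Comp U′ y u → Comp U′ u v → Reach (AdjBulletExcept i) (S i) u v
        except-reach i∈ r (stop u∉)    = stop (proj₂ (off-bag r) ∘ S⊆core i∈)
        except-reach i∈ r (go u∉ e r′) = go (proj₂ (off-bag r) ∘ S⊆core i∈)
          (except-edge i∈ (proj₁ (off-bag r)) e)
          (except-reach i∈ (reach-trans r (reach-edge u∉ (reach-source r′) e)) r′)

        ∂ : Subset n
        ∂ = boundary U′ y

        -- Two such vertices are joined through the remaining component by a walk in `H^{•∖i}` minus
        -- `S i`, where `i` is the color of `z`.
        ∂-unique : ∀ {z z′} → z ∈ ∂ → z′ ∈ ∂ → col z ∈ B → col z′ ∈ B →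
                   z ∉ core B → z′ ∉ core B → z ≡ z′
        ∂-unique z∈ z′∈ z∈B z′∈B z∉ z′∉ with boundary⁻ z∈ | boundary⁻ z′∈
        ... | _ , v , r , e | _ , v′ , r′ , e′ = linked⇒≡ z∈B z′∈B z∉
          (go (z∉ ∘ S⊆core z∈B) (except-sym H _ (except-edge z∈B (proj₁ (off-bag r)) e))
            (reach-trans (except-reach z∈B r (reach-trans (reach-sym (bullet-sym H) r) r′))
              (reach-edge (proj₂ (off-bag r′) ∘ S⊆core z∈B) (z′∉ ∘ S⊆core z∈B)
                (except-edge z∈B (proj₁ (off-bag r′)) e′))))

        ∂⊆bag : ∀ {z} → z ∈ ∂ → z ∈ newBag
        ∂⊆bag z∈ with boundary⁻ z∈
        ... | z∈U′ , v , r , e with x∈p∪q⁻ U newBag z∈U′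
        ...   | inj₁ z∈U   = g⊆bag (boundary⊆guard (boundary⁺ z∈U (D⁻ (in-D r)) e))
        ...   | inj₂ z∈bag = z∈bag

        open LightSide (proj₂ balanced-node (col y) (proj₁ (off-bag (stop y∉U′))))

        -- A clique edge keeps the color, and an edge of `H` keeps it or projects to an edge of `Ĥ`.
        -- Hence the component of `y` never leaves the light side.
        side-edge : ∀ {u v} → Side (col u) → col u ∉ B → col v ∉ B → AdjBullet u v → Side (col v)
        side-edge s u∉ v∉ (inj₂ (eq , _)) = subst Side eq s
        side-edge {u} {v} s u∉ v∉ (inj₁ e) with col u ≟ col v
        ... | yes eq = subst Side eq s
        ... | no neq = closed s u∉ v∉ (neq , u , v , refl , refl , e)

        side-reach : ∀ {u v} → Side (col u) → Comp U′ y u → Comp U′ u v → Side (col v)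
        side-reach s r (stop _)      = s
        side-reach s r (go u∉ e r′) = side-reach
          (side-edge s (proj₁ (off-bag r)) (proj₁ (off-bag r⁺)) e) r⁺ r′
          where r⁺ = reach-trans r (reach-edge u∉ (reach-source r′) e)

        M : Subset n
        M = ∂ ∩ (B̂ ─ core B)

        M⁻ : ∀ {z} → z ∈ M → z ∈ ∂ × col z ∈ B × z ∉ core B
        M⁻ z∈ with x∈p∩q⁻ ∂ (B̂ ─ core B) z∈
        ... | z∈∂ , z∈BC = z∈∂ , B̂⁻ (p─q⊆p B̂ (core B) z∈BC) , x∈p─q⇒x∉q B̂ (core B) z∈BC

        ∣M∣≤1 : ∣ M ∣ ≤ 1
        ∣M∣≤1 = subsingleton⇒∣p∣≤1 M λ z∈ z′∈ →
          let z∈∂ , z∈B , z∉ = M⁻ z∈ ; z′∈∂ , z′∈B , z′∉ = M⁻ z′∈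
          in ∂-unique z∈∂ z′∈∂ z∈B z′∈B z∉ z′∉

        -- Outside `K` and the classes of `B`, a boundary vertex is guarded and therefore already in
        -- `X`; being adjacent to the component of `y`, it has a color on the light side.
        ∂⊆ : ∀ {z} → z ∈ ∂ → z ∈ K ∪ (M ∪ Q)
        ∂⊆ {z} z∈ with z ∈? K
        ... | yes z∈K = x∈p∪q⁺ (inj₁ z∈K)
        ... | no  z∉K with col z ∈? B
        ...   | yes z∈B = x∈p∪q⁺ {p = K} (inj₂ (x∈p∪q⁺ (inj₁
                (x∈p∩q⁺ (z∈ , x∈p∧x∉q⇒x∈p─q (B̂⁺ z∈B) (z∉K ∘ core⊆K))))))
        ...   | no  z∉B = x∈p∪q⁺ {p = K} (inj₂ (x∈p∪q⁺ {p = M} (inj₂ (inQ z∈X side))))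
          where
          z∈g : z ∈ newGuard
          z∈g with z ∈? newGuard
          ... | yes z∈g = z∈g
          ... | no  z∉g = ⊥-elim (z∉B (proj₁ (proj₂ (unguarded (∂⊆bag z∈) z∉g))))
          z∈X : z ∈ X
          z∈X with x∈p∪q⁻ X (D ∩ K) z∈g
          ... | inj₁ z∈X  = z∈X
          ... | inj₂ z∈DK = ⊥-elim (z∉K (proj₂ (x∈p∩q⁻ D K z∈DK)))
          side : Side (col z)
          side with boundary⁻ z∈
          ... | _ , v , r , e = side-edge (side-reach inSide (stop y∉U′) r) (proj₁ (off-bag r)) z∉B e

        half : ∀ {a b} → a + a ≤ b + b → a ≤ b
        half {a} {b} h with a ≤? b
        ... | yes a≤b = a≤b
        ... | no  a≰b = ⊥-elim (ℕ.<⇒≱ (ℕ.+-mono-< (ℕ.≰⇒> a≰b) (ℕ.≰⇒> a≰b)) h)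

        ∣∂′∣≤ : ∣ ∂ ∣ ≤ adhesionBound
        ∣∂′∣≤ = begin
          ∣ ∂ ∣                        ≤⟨ ∣∣-mono ∂ (K ∪ (M ∪ Q)) ∂⊆ ⟩
          ∣ K ∪ (M ∪ Q) ∣              ≤⟨ ∣p∪q∣≤∣p∣+∣q∣ K (M ∪ Q) ⟩
          ∣ K ∣ + ∣ M ∪ Q ∣            ≤⟨ ℕ.+-mono-≤ ∣K∣≤ (∣p∪q∣≤∣p∣+∣q∣ M Q) ⟩
          suc coreBound + (∣ M ∣ + ∣ Q ∣) ≤⟨ ℕ.+-monoʳ-≤ (suc coreBound)
                                            (ℕ.+-mono-≤ ∣M∣≤1 (half (ℕ.≤-trans light ∣∂∣≤))) ⟩
          suc coreBound + suc (2 + coreBound) ≡⟨ ℕ.+-suc (suc coreBound) (2 + coreBound) ⟩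
          adhesionBound                ∎
          where open ℕ.≤-Reasoning

      new-boundary : Attachable newBag newGuard (boundary U′ y)
      new-boundary = record { P⊆β = ∂⊆bag ; ∣P∣≤ = ∣∂′∣≤
                            ; ∣P─g∣≤ = subsingleton⇒∣p∣≤1 (∂ ─ newGuard) λ z∈ z′∈ →
        let z∈∂  = p─q⊆p ∂ newGuard z∈
            z′∈∂ = p─q⊆p ∂ newGuard z′∈
            _ , z∈B  , z∉  = unguarded (∂⊆bag z∈∂)  (x∈p─q⇒x∉q ∂ newGuard z∈)
            _ , z′∈B , z′∉ = unguarded (∂⊆bag z′∈∂) (x∈p─q⇒x∉q ∂ newGuard z′∈)
        in ∂-unique z∈∂ z′∈∂ z∈B z′∈B z∉ z′∉ }

-- Growing the decomposition one bag at a time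

module _ {A : Set} where

  snoc : ∀ {m} → (Fin m → A) → A → Fin (suc m) → A
  snoc {zero}  f a _       = a
  snoc {suc m} f a zero    = f zero
  snoc {suc m} f a (suc i) = snoc (f ∘ suc) a i

  snoc-inject₁ : ∀ {m} (f : Fin m → A) a i → snoc f a (inject₁ i) ≡ f i
  snoc-inject₁ f a zero    = refl
  snoc-inject₁ f a (suc i) = snoc-inject₁ (f ∘ suc) a i

  snoc-fromℕ : ∀ {m} (f : Fin m → A) a → snoc f a (fromℕ m) ≡ a
  snoc-fromℕ {zero}  f a = refl
  snoc-fromℕ {suc m} f a = snoc-fromℕ (f ∘ suc) a

-- The leaf receives the greatest number, so parents still precede their children and old nodes
-- embed by `inject₁`.
module Leaf (T : RootedTree) (p : RootedTree.Node T) where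

  open RootedTree T using (m; parent; parent<)
  open RootedTree using (WalkIn; here; step; TAdj; IsParentOf)

  private
    parent′ : Fin (suc m) → Fin (suc (suc m))
    parent′ = snoc (inject₁ ∘ parent) (inject₁ p)

  parent-old : ∀ i → parent′ (inject₁ i) ≡ inject₁ (parent i)
  parent-old = snoc-inject₁ (inject₁ ∘ parent) (inject₁ p)

  parent-new : parent′ (fromℕ m) ≡ inject₁ p
  parent-new = snoc-fromℕ (inject₁ ∘ parent) (inject₁ p)

  grown : RootedTree
  grown = record { m = suc m ; parent = parent′ ; parent< = earlier }
    where
    earlier : ∀ i → toℕ (parent′ i) ≤ toℕ i
    earlier i with view i
    ... | ‵inject₁ j rewrite parent-old j | Fin.toℕ-inject₁ (parent j) | Fin.toℕ-inject₁ j = parent< j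
    ... | ‵fromℕ rewrite parent-new | Fin.toℕ-inject₁ p | Fin.toℕ-fromℕ m = Fin.toℕ≤pred[n] p

  leaf : RootedTree.Node grown
  leaf = fromℕ (suc m)

  leaf-parent : IsParentOf grown leaf (inject₁ p)
  leaf-parent = parent-new

  embed-parent : ∀ a b → IsParentOf T a b → IsParentOf grown (inject₁ a) (inject₁ b)
  embed-parent (suc i) b eq = trans (parent-old i) (cong inject₁ eq)

  embed : ∀ {S S′ a b} → (∀ {t} → S t → S′ (inject₁ t)) →
          WalkIn T S a b → WalkIn grown S′ (inject₁ a) (inject₁ b)
  embed h (here s)                       = here (h s)
  embed h (step {a} {b} s (inj₁ a↑b) w) = step (h s) (inj₁ (embed-parent a b a↑b)) (embed h w)
  embed h (step {a} {b} s (inj₂ b↑a) w) = step (h s) (inj₂ (embed-parent b a b↑a)) (embed h w)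

  walk-snoc : ∀ {S a b c} → WalkIn grown S a b → TAdj grown b c → S c → WalkIn grown S a c
  walk-snoc (here s)     b~c sc = step s b~c (here sc)
  walk-snoc (step s e w) b~c sc = step s e (walk-snoc w b~c sc)

-- The invariant of the growth

module Assembly (H : ColoredGraph) {w c : ℕ}
                (TDH : TreeDecomposition (ColoredGraph.AdjHat H))
                (narrow : ∀ t → ∣ TreeDecomposition.β TDH t ∣ ≤ suc w)
                (separator : ∀ i → ∃[ Z ] (∣ Z ∣ ≤ c * 4 × SeparatesClass H i Z)) where

  open ColoredGraph H
  open Step H {w} {c} TDH narrow separator

  attachable-⊆ : ∀ {β g P P′} → (∀ {v} → v ∈ P′ → v ∈ P) → Attachable β g P → Attachable β g P′
  attachable-⊆ {g = g} {P} {P′} P′⊆P A = record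
    { P⊆β = P⊆β ∘ P′⊆P
    ; ∣P∣≤ = ℕ.≤-trans (∣∣-mono P′ P P′⊆P) ∣P∣≤
    ; ∣P─g∣≤ = ℕ.≤-trans (∣∣-mono (P′ ─ g) (P ─ g) λ v∈ →
        x∈p∧x∉q⇒x∈p─q (P′⊆P (p─q⊆p P′ g v∈)) (x∈p─q⇒x∉q P′ g v∈)) ∣P─g∣≤ }
    where open Attachable A

  -- A guarded cutvertex decomposition of the part of `H` on `U`. The invariant that lets it grow is
  -- `pending`: the neighborhood of each outside component fits below a single node.
  record State : Set where
    field
      T : RootedTree
    open RootedTree T
    field
      β g      : Node → Subset n
      U        : Subset n
      β⊆U      : ∀ {t v} → v ∈ β t → v ∈ U
      U⊆β      : ∀ {v} → v ∈ U → ∃[ t ] v ∈ β t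
      edges    : ∀ {u v} → u ∈ U → v ∈ U → AdjBullet u v → ∃[ t ] (u ∈ β t × v ∈ β t)
      connects : ∀ {v} a b → v ∈ β a → v ∈ β b → WalkIn (λ t → v ∈ β t) a b
      bag      : ∀ t → IsGuardedBag (β t) (g t)
      σ⊆g      : ∀ i {v} → v ∈ β (suc i) → v ∈ β (parent i) → v ∈ g (suc i)
      child    : ∀ i → ∣ β (suc i) ∩ β (parent i) ─ g (parent i) ∣ ≤ 1
      pending  : ∀ {x} → x ∉ U → ∃[ p ] Attachable (β p) (g p) (boundary U x)

  -- With `U` empty every boundary is empty, so any component can be hung below the empty root.
  initial : State
  initial = record
    { T = record { m = 0 ; parent = λ () ; parent< = λ () }
    ; β = λ _ → ∅ ; g = λ _ → ∅ ; U = ∅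
    ; β⊆U = id ; U⊆β = ⊥-elim ∘ ∉⊥ ; edges = ⊥-elim ∘ ∉⊥ ; connects = λ _ _ v∈ _ → ⊥-elim (∉⊥ v∈)
    ; bag = λ _ → record { g⊆β = id ; cover = λ _ → ⊥-elim ∘ ∉⊥
                         ; ∣g∣≤ = small {n} ∅ id ; colors≤ = small (colors ∅) noColors }
    ; σ⊆g = λ () ; child = λ ()
    ; pending = λ {x} _ → zero , record { P⊆β = proj₁ ∘ boundary⁻ ; ∣P∣≤ = small (boundary ∅ x) (proj₁ ∘ boundary⁻)
                                    ; ∣P─g∣≤ = small (boundary ∅ x ─ ∅) (proj₁ ∘ boundary⁻ ∘ p─q⊆p (boundary ∅ x) ∅) } }
    where
    small : ∀ {n M} (p : Subset n) → (∀ {x} → x ∈ p → x ∈ ∅) → ∣ p ∣ ≤ M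
    small {n} p h =
      ℕ.≤-trans (∣∣-mono p ∅ h) (ℕ.≤-trans (ℕ.≤-reflexive (∣⊥∣≡0 n)) z≤n)
    noColors : ∀ {j} → j ∈ colors ∅ → j ∈ ∅
    noColors j∈ with ∈-select⁻ (λ j → any? λ u → u ∈? ∅ ×-dec col u ≟ j) j∈
    ... | _ , u∈ , _ = ⊥-elim (∉⊥ u∈)

  module Extend (s : State) {x : Fin n} (x∉U : x ∉ State.U s) where

    open State s
    open RootedTree T hiding (here; step)
    open RootedTree using (here; step)

    private
      p : Node
      p = proj₁ (pending x∉U)
      open Attachable (proj₂ (pending x∉U))
      open Leaf T p
      bag⁺ guard⁺ : Subset n
      bag⁺   = newBag U x∉U ∣P∣≤
      guard⁺ = newGuard U x∉U ∣P∣≤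

    β′ g′ : Fin (suc (suc m)) → Subset n
    β′ = snoc β bag⁺
    g′ = snoc g guard⁺

    private
      β-old : ∀ t → β′ (inject₁ t) ≡ β t
      β-old = snoc-inject₁ β bag⁺
      β-new : β′ leaf ≡ bag⁺
      β-new = snoc-fromℕ β bag⁺
      g-old : ∀ t → g′ (inject₁ t) ≡ g t
      g-old = snoc-inject₁ g guard⁺
      g-new : g′ leaf ≡ guard⁺
      g-new = snoc-fromℕ g guard⁺

      old⁺ : ∀ t {v} → v ∈ β t → v ∈ β′ (inject₁ t)
      old⁺ t {v} = subst (v ∈_) (sym (β-old t))
      old⁻ : ∀ t {v} → v ∈ β′ (inject₁ t) → v ∈ β t
      old⁻ t {v} = subst (v ∈_) (β-old t)
      new⁺ : ∀ {v} → v ∈ bag⁺ → v ∈ β′ leaf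
      new⁺ {v} = subst (v ∈_) (sym β-new)
      new⁻ : ∀ {v} → v ∈ β′ leaf → v ∈ bag⁺
      new⁻ {v} = subst (v ∈_) β-new

      U′ : Subset n
      U′ = U ∪ bag⁺

      fresh⊎boundary : ∀ {v} → v ∈ bag⁺ → v ∈ boundary U x ⊎ Comp U x v
      fresh⊎boundary = newBag⊆ U x∉U ∣P∣≤

      -- The rest of the new bag lies in D, outside `U`. So it meets old bags only in N(D), which
      -- lies in the bag of `p` and in the new guard; this yields connectivity and both adhesion
      -- conditions.
      shared : ∀ {v} → v ∈ U → v ∈ bag⁺ → v ∈ boundary U x
      shared v∈U v∈ with fresh⊎boundary v∈
      ... | inj₁ v∈∂ = v∈∂
      ... | inj₂ r   = ⊥-elim (reach-target r v∈U)

      β⊆U′ : ∀ t {v} → v ∈ β′ t → v ∈ U′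
      β⊆U′ t v∈ with view t
      ... | ‵inject₁ j = x∈p∪q⁺ (inj₁ (β⊆U (old⁻ j v∈)))
      ... | ‵fromℕ     = x∈p∪q⁺ {p = U} (inj₂ (new⁻ v∈))

      U′⊆β : ∀ {v} → v ∈ U′ → ∃[ t ] v ∈ β′ t
      U′⊆β v∈ with x∈p∪q⁻ U bag⁺ v∈
      ... | inj₁ v∈U = let t , v∈t = U⊆β v∈U in inject₁ t , old⁺ t v∈t
      ... | inj₂ v∈b = leaf , new⁺ v∈b

      -- No edge escapes coverage: an old vertex adjacent to D belongs to N(D) and hence to the new
      -- bag.
      old-new : ∀ {u v} → u ∈ U → v ∈ bag⁺ → AdjBullet u v →
                (u ∈ bag⁺ × v ∈ bag⁺) ⊎ (u ∈ U × v ∈ U)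
      old-new u∈U v∈b e with fresh⊎boundary v∈b
      ... | inj₁ v∈∂ = inj₂ (u∈U , proj₁ (boundary⁻ v∈∂))
      ... | inj₂ r   = inj₁ (g⊆β (boundary⊆guard U x∉U ∣P∣≤ (boundary⁺ u∈U r (bullet-sym H e))) , v∈b)
        where open IsGuardedBag (newBag-guarded U x∉U ∣P∣≤)

      both : ∀ {u v} → u ∈ U′ → v ∈ U′ → AdjBullet u v →
             (u ∈ bag⁺ × v ∈ bag⁺) ⊎ (u ∈ U × v ∈ U)
      both u∈ v∈ e with x∈p∪q⁻ U bag⁺ u∈ | x∈p∪q⁻ U bag⁺ v∈
      ... | inj₁ u∈U | inj₁ v∈U = inj₂ (u∈U , v∈U)
      ... | inj₂ u∈b | inj₂ v∈b = inj₁ (u∈b , v∈b)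
      ... | inj₁ u∈U | inj₂ v∈b = old-new u∈U v∈b e
      ... | inj₂ u∈b | inj₁ v∈U with old-new v∈U u∈b (bullet-sym H e)
      ...   | inj₁ (v∈ , u∈) = inj₁ (u∈ , v∈)
      ...   | inj₂ (v∈ , u∈) = inj₂ (u∈ , v∈)

      edges′ : ∀ {u v} → u ∈ U′ → v ∈ U′ → AdjBullet u v → ∃[ t ] (u ∈ β′ t × v ∈ β′ t)
      edges′ u∈ v∈ e with both u∈ v∈ e
      ... | inj₁ (u∈b , v∈b) = leaf , new⁺ u∈b , new⁺ v∈b
      ... | inj₂ (u∈U , v∈U) = let t , u∈t , v∈t = edges u∈U v∈U e in inject₁ t , old⁺ t u∈t , old⁺ t v∈t

      at-parent : ∀ {t v} → v ∈ β t → v ∈ bag⁺ → v ∈ β p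
      at-parent v∈t v∈b = P⊆β (shared (β⊆U v∈t) v∈b)

      connects′ : ∀ {v} a b → v ∈ β′ a → v ∈ β′ b →
                  RootedTree.WalkIn grown (λ t → v ∈ β′ t) a b
      connects′ a b v∈a v∈b with view a | view b
      ... | ‵inject₁ i | ‵inject₁ j = embed (λ {t} → old⁺ t) (connects i j (old⁻ i v∈a) (old⁻ j v∈b))
      ... | ‵fromℕ     | ‵fromℕ     = here v∈a
      ... | ‵inject₁ i | ‵fromℕ     = walk-snoc
        (embed (λ {t} → old⁺ t) (connects i p (old⁻ i v∈a) (at-parent (old⁻ i v∈a) (new⁻ v∈b)))) (inj₂ leaf-parent) v∈b
      ... | ‵fromℕ     | ‵inject₁ j = step v∈a (inj₁ leaf-parent)
        (embed (λ {t} → old⁺ t) (connects p j (at-parent (old⁻ j v∈b) (new⁻ v∈a)) (old⁻ j v∈b)))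

      bag′ : ∀ t → IsGuardedBag (β′ t) (g′ t)
      bag′ t with view t
      ... | ‵inject₁ j = subst₂ IsGuardedBag (sym (β-old j)) (sym (g-old j)) (bag j)
      ... | ‵fromℕ     = subst₂ IsGuardedBag (sym β-new) (sym g-new) (newBag-guarded U x∉U ∣P∣≤)

      open RootedTree grown using () renaming (parent to parent′)

      σ⊆g′ : ∀ i {v} → v ∈ β′ (suc i) → v ∈ β′ (parent′ i) → v ∈ g′ (suc i)
      σ⊆g′ i {v} v∈ v∈p with view i
      ... | ‵inject₁ j = subst (v ∈_) (sym (g-old (suc j)))
        (σ⊆g j (old⁻ (suc j) v∈) (old⁻ (parent j) (subst (λ t → v ∈ β′ t) (parent-old j) v∈p)))
      ... | ‵fromℕ     = subst (v ∈_) (sym g-new) (boundary⊆guard U x∉U ∣P∣≤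
        (shared (β⊆U (old⁻ p (subst (λ t → v ∈ β′ t) parent-new v∈p))) (new⁻ v∈)))

      child′ : ∀ i → ∣ β′ (suc i) ∩ β′ (parent′ i) ─ g′ (parent′ i) ∣ ≤ 1
      child′ i with view i
      ... | ‵inject₁ j rewrite parent-old j | β-old (suc j) | β-old (parent j) | g-old (parent j) = child j
      ... | ‵fromℕ rewrite parent-new | β-new | β-old p | g-old p =
        ℕ.≤-trans (∣∣-mono (bag⁺ ∩ β p ─ g p) (boundary U x ─ g p) λ v∈ →
          let v∈b , v∈p = x∈p∩q⁻ bag⁺ (β p) (p─q⊆p (bag⁺ ∩ β p) (g p) v∈)
          in x∈p∧x∉q⇒x∈p─q (shared (β⊆U v∈p) v∈b) (x∈p─q⇒x∉q (bag⁺ ∩ β p) (g p) v∈)) ∣P─g∣≤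

      -- Components inside D are hung below the new leaf; the others keep their node, since their
      -- boundary has not grown.
      pending′ : ∀ {y} → y ∉ U′ → ∃[ q ] Attachable (β′ q) (g′ q) (boundary U′ y)
      pending′ {y} y∉ with comp? U x y
      ... | yes r = leaf , subst₂ (λ β g → Attachable β g (boundary U′ y)) (sym β-new) (sym g-new)
                             (new-boundary U x∉U ∣P∣≤ y∉ r)
      ... | no ¬r = let q , A = pending (y∉ ∘ x∈p∪q⁺ ∘ inj₁) in
        inject₁ q , subst₂ (λ β g → Attachable β g (boundary U′ y)) (sym (β-old q)) (sym (g-old q))
                      (attachable-⊆ (old-boundary U x∉U ∣P∣≤ ¬r) A)

    extended : State
    extended = record
      { T = grown ; β = β′ ; g = g′ ; U = U′
      ; β⊆U = λ {t} → β⊆U′ t ; U⊆β = U′⊆β ; edges = edges′ ; connects = connects′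
      ; bag = bag′ ; σ⊆g = σ⊆g′ ; child = child′ ; pending = pending′ }

    smaller : ∣ ∁ (State.U extended) ∣ < ∣ ∁ U ∣
    smaller = p⊂q⇒∣p∣<∣q∣ (p⊂q⇒∁p⊃∁q
      (p⊆p∪q bag⁺ , x , x∈p∪q⁺ {p = U} (inj₂ (x∈newBag U x∉U ∣P∣≤)) , x∉U))

  complete : ∃[ s ] (∀ v → v ∈ State.U s)
  complete = run (suc ∣ ∁ (State.U initial) ∣) initial ℕ.≤-refl
    where
    run : ∀ f s → ∣ ∁ (State.U s) ∣ < f → ∃[ s ] (∀ v → v ∈ State.U s)
    run (suc f) s (s≤s ∣∁U∣≤f) with any? (λ v → ¬? (v ∈? State.U s))
    ... | yes (x , x∉U) = run f (Extend.extended s x∉U) (ℕ.<-≤-trans (Extend.smaller s x∉U) ∣∁U∣≤f)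
    ... | no  all∈      = s , λ v → decidable-stable (v ∈? State.U s) (λ v∉ → all∈ (v , v∉))

  private
    s = proj₁ complete
    open State s
    open RootedTree T

  treeDecomposition : TreeDecomposition AdjBullet
  treeDecomposition = record
    { T = T ; β = β ; cover-v = λ v → U⊆β (proj₂ complete v)
    ; cover-e = λ u v → edges (proj₂ complete u) (proj₂ complete v)
    ; connected = λ v → connects {v} }

  decomposition : GuardedCutvertexDecomposition H
  decomposition = record
    { TD = treeDecomposition ; g = g
    ; σ⊆g = λ { zero v∈ → ⊥-elim (∉⊥ v∈)
              ; (suc i) v∈ → let v∈i , v∈p = x∈p∩q⁻ (β (suc i)) (β (parent i)) v∈ in σ⊆g i v∈i v∈p }
    ; g⊆β = λ t → IsGuardedBag.g⊆β (bag t)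
    ; cover = λ t u v → IsGuardedBag.cover (bag t)
    ; child = child }

  ∣guard∣≤ : ∀ t → ∣ g t ∣ ≤ guardBound
  ∣guard∣≤ t = IsGuardedBag.∣g∣≤ (bag t)

  opaque
    -- `colorsIn` is a bare `tabulate`, which agrees with `colors` only once `select` unfolds.
    unfolding select

    colorsIn≤ : ∀ t → GuardedCutvertexDecomposition.colorsIn decomposition t ≤ colorBound
    colorsIn≤ t = IsGuardedBag.colors≤ (bag t)

  -- Numerical bounds

  module _ (1≤w : 1 ≤ w) where

    private
      M : ℕ
      M = (c + w) * w

      1≤M : 1 ≤ M
      1≤M = ℕ.*-mono-≤ (ℕ.≤-trans 1≤w (ℕ.m≤n+m w c)) 1≤w

      coreBound≤ : coreBound ≤ 8 * M
      coreBound≤ = begin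
        suc w * (c * 4 + suc w)   ≤⟨ ℕ.*-mono-≤ 1+w≤2w (ℕ.+-monoʳ-≤ (c * 4) 1+w≤2w) ⟩
        -- Raising `w + w` to four copies matches the coefficient of `c`, so the product is 2w times
        -- 4(c + w).
        (w + w) * (c * 4 + (w + w)) ≤⟨ ℕ.*-monoʳ-≤ (w + w) (ℕ.+-monoʳ-≤ (c * 4) (ℕ.m≤m+n (w + w) (w + w))) ⟩
        (w + w) * (c * 4 + ((w + w) + (w + w))) ≡⟨ eq w c ⟩
        8 * M                     ∎
        where
        open ℕ.≤-Reasoning
        1+w≤2w : suc w ≤ w + w
        1+w≤2w = ℕ.+-monoˡ-≤ w 1≤w
        eq : ∀ w c → (w + w) * (c * 4 + ((w + w) + (w + w))) ≡ 8 * ((c + w) * w)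
        eq = solve-∀

      guardBound≤29M : guardBound ≤ 29 * M
      guardBound≤29M = begin
        guardBound                ≡⟨ eq coreBound ⟩
        5 * 1 + 3 * coreBound     ≤⟨ ℕ.+-mono-≤ (ℕ.*-monoʳ-≤ 5 1≤M) (ℕ.*-monoʳ-≤ 3 coreBound≤) ⟩
        5 * M + 3 * (8 * M)       ≡⟨ eq′ M ⟩
        29 * M                    ∎
        where
        open ℕ.≤-Reasoning
        eq : ∀ C → (2 + C) + (2 + C) + suc C ≡ 5 * 1 + 3 * C
        eq = solve-∀
        eq′ : ∀ M → 5 * M + 3 * (8 * M) ≡ 29 * M
        eq′ = solve-∀

    colorBound≤ : colorBound ≤ 31 * ((c + w) * w)
    colorBound≤ = begin
      -- The constant is 29 from the guard, plus one `M` each for `1` and `w`.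
      guardBound + suc w   ≤⟨ ℕ.+-mono-≤ guardBound≤29M (ℕ.+-mono-≤ 1≤M w≤M) ⟩
      29 * M + (M + M)     ≡⟨ eq M ⟩
      31 * M               ∎
      where
      open ℕ.≤-Reasoning
      w≤M : w ≤ M
      w≤M = ℕ.m≤n*m w (c + w) {{>-nonZero (ℕ.≤-trans 1≤w (ℕ.m≤n+m w c))}}
      eq : ∀ M → 29 * M + (M + M) ≡ 31 * M
      eq = solve-∀

    -- The guard is already linear in `M`; since `M` is at least 1, passing to its square gives the
    -- stated form.
    guardBound≤ : guardBound ≤ 31 * ((w + c) ^ 2 * w ^ 2)
    guardBound≤ = begin
      guardBound                   ≤⟨ ℕ.m≤m+n guardBound (suc w) ⟩
      colorBound                   ≤⟨ colorBound≤ ⟩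
      31 * M                       ≤⟨ ℕ.*-monoʳ-≤ 31 (ℕ.m≤m*n M M {{>-nonZero 1≤M}}) ⟩
      31 * (M * M)                 ≡⟨ cong (31 *_) (eq w c) ⟩
      31 * ((w + c) ^ 2 * w ^ 2)   ∎
      where
      open ℕ.≤-Reasoning
      eq : ∀ w c → ((c + w) * w) * ((c + w) * w) ≡ (w + c) * ((w + c) * 1) * (w * (w * 1))
      eq = solve-∀

theorem6p3 : ∃[ K ] ((H : ColoredGraph) (w c : ℕ) → 1 ≤ w →
    TreewidthAtMost (ColoredGraph.AdjHat H) w →
    (∀ i → ¬ Flower H c i) →
    Σ (GuardedCutvertexDecomposition H) λ D →
    (∀ t → ∣ GuardedCutvertexDecomposition.g D t ∣ ≤ K * ((w + c) ^ 2 * w ^ 2))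
    × (∀ t → GuardedCutvertexDecomposition.colorsIn D t ≤ K * ((c + w) * w)))
theorem6p3 = 31 , λ H w c 1≤w (TDH , narrow) noFlower →
  let separator : ∀ i → ∃[ Z ] (∣ Z ∣ ≤ c * 4 × SeparatesClass H i Z)
      separator i = [ ⊥-elim ∘ noFlower i , id ]′ (flower-or-separator H c i)
      open Assembly H {w} {c} TDH narrow separator
  in decomposition , (λ t → ℕ.≤-trans (∣guard∣≤ t) (guardBound≤ 1≤w))
                   , (λ t → ℕ.≤-trans (colorsIn≤ t) (colorBound≤ 1≤w))
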